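{- Let $p$ be a prime and let $S\subseteq\mathbb{F}_p^3$ be a $p$-divisible set of size $p^2$, i.e. $|S|=p^2$ and $|S\cap H|\equiv 0\pmod p$ for every affine plane $H\subseteq\mathbb{F}_p^3$. Then $\mathbf{1}_S$ is a $\mathbb{Z}$-linear combination of characteristic functions of cylinders. Alternatively, $\mathbf{1}_S$ is the sum of the characteristic function of an affine plane and an element of $\operatorname{Span}_{\mathbb{Z}}\{\mathbf{1}_{\ell_1}-\mathbf{1}_{\ell_2} : \ell_1,\ell_2 \text{ affine lines in } \mathbb{F}_p^3,\ \ell_1\parallel\ell_2\}$.
   Context: Lines and planes are affine one- and two-dimensional subspaces of $\mathbb{F}_p^3$. For $X\subseteq\mathbb{F}_p^3$, $\mathbf{1}_X:\mathbb{F}_p^3\to\mathbb{Z}$ denotes its characteristic function. Write $\ell_1\parallel\ell_2$ if the lines $\ell_1,\ell_2$ are parallel. A cylinder is a subset of $\mathbb{F}_p^3$ that is the union of $p$ pairwise disjoint parallel lines. $\operatorname{Span}_{\mathbb{Z}}$ denotes the set of finite integer linear combinations. -}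

module Defs where

open import Data.Bool.Base using (Bool; true; _∧_; if_then_else_)
open import Data.Fin.Base using (Fin; toℕ)
open import Data.Integer.Base using (ℤ; 0ℤ; 1ℤ)
open import Data.List.Base using (List; length; [_]; filterᵇ; allFin; cartesianProductWith)
open import Data.Nat.Base using (ℕ; zero; suc; NonZero)
open import Data.Nat.Divisibility using (_∣_)
open import Data.Nat.DivMod using (_mod_)
open import Data.Product.Base using (Σ; ∃-syntax; _×_)
open import Data.Vec.Base using (Vec; []; _∷_; foldr; map; replicate; zipWith)
open import Function.Bundles using (_⇔_)
open import Relation.Binary.PropositionalEquality using (_≡_; _≢_; _≗_)
open import Relation.Nullary using (¬_)
import Data.Integer.Base as ℤ
import Data.Integer.Properties as ℤ
import Data.Nat.Base as ℕ
open import Algebra.Properties.Semiring.Sum ℤ.+-*-semiring using (sum)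

-- The ring ℤ/p on residues 0, …, p-1; it is the field 𝔽_p when p is prime.
module AffineSpace (p : ℕ) .{{_ : NonZero p}} where

  𝔽 : Set
  𝔽 = Fin p

  0𝔽 : 𝔽
  0𝔽 = 0 mod p

  infixl 6 _+𝔽_ _+ᵥ_
  infixl 7 _*𝔽_ _*ᵥ_

  _+𝔽_ _*𝔽_ : 𝔽 → 𝔽 → 𝔽
  a +𝔽 b = (toℕ a ℕ.+ toℕ b) mod p
  a *𝔽 b = (toℕ a ℕ.* toℕ b) mod p

  Point : Set
  Point = Vec 𝔽 3

  0ᵥ : Point
  0ᵥ = replicate 3 0𝔽

  _+ᵥ_ : Point → Point → Point
  _+ᵥ_ = zipWith _+𝔽_

  _*ᵥ_ : 𝔽 → Point → Point
  c *ᵥ u = map (c *𝔽_) u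

  combination : ∀ {k} → Vec 𝔽 k → Vec Point k → Point
  combination cs us = foldr (λ _ → Point) _+ᵥ_ 0ᵥ (zipWith _*ᵥ_ cs us)

  LinearlyIndependent : ∀ {k} → Vec Point k → Set
  LinearlyIndependent {k} us = ∀ cs → combination cs us ≡ 0ᵥ → cs ≡ replicate k 0𝔽

  -- Every subset of the finite set 𝔽_p³ is decidable, so subsets are taken to
  -- be Boolean-valued functions.
  PointSet : Set
  PointSet = Point → Bool

  infix 4 _∈_ _∥_

  _∈_ : Point → PointSet → Set
  x ∈ X = X x ≡ true

  _∩_ : PointSet → PointSet → PointSet
  (X ∩ Y) x = X x ∧ Y x

  Disjoint : PointSet → PointSet → Set
  Disjoint X Y = ∀ x → ¬ (x ∈ X × x ∈ Y)

  -- Lists each vector exactly once.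
  vectors : ∀ n → List (Vec 𝔽 n)
  vectors zero    = [ [] ]
  vectors (suc n) = cartesianProductWith _∷_ (allFin p) (vectors n)

  ∣_∣ₛ : PointSet → ℕ
  ∣ X ∣ₛ = length (filterᵇ X (vectors 3))

  𝟙 : PointSet → Point → ℤ
  𝟙 X x = if X x then 1ℤ else 0ℤ

  -- X = a + span(us)
  IsTranslateOfSpan : ∀ {k} → PointSet → Point → Vec Point k → Set
  IsTranslateOfSpan X a us = ∀ x → x ∈ X ⇔ (∃[ cs ] x ≡ a +ᵥ combination cs us)

  IsAffineSubspace : ℕ → PointSet → Set
  IsAffineSubspace k X =
    ∃[ a ] Σ (Vec Point k) λ us → LinearlyIndependent us × IsTranslateOfSpan X a us

  IsLine IsPlane : PointSet → Set
  IsLine  = IsAffineSubspace 1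
  IsPlane = IsAffineSubspace 2

  -- Lines with a common direction vector; a line is parallel to itself.
  _∥_ : PointSet → PointSet → Set
  ℓ₁ ∥ ℓ₂ = ∃[ u ] LinearlyIndependent (u ∷ []) ×
    (∃[ a ] IsTranslateOfSpan ℓ₁ a (u ∷ [])) × (∃[ b ] IsTranslateOfSpan ℓ₂ b (u ∷ []))

  IsCylinder : PointSet → Set
  IsCylinder X = Σ (Fin p → PointSet) λ ℓ →
    (∀ i → IsLine (ℓ i)) ×
    (∀ i j → ℓ i ∥ ℓ j) ×
    (∀ i j → i ≢ j → Disjoint (ℓ i) (ℓ j)) ×
    (∀ x → x ∈ X ⇔ (∃[ i ] x ∈ ℓ i))

  IsDivisible : PointSet → Set
  IsDivisible S = ∀ H → IsPlane H → p ∣ ∣ S ∩ H ∣ₛ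

  -- Functions are compared pointwise, here and in the two generating families
  -- below.
  Spanℤ : ((Point → ℤ) → Set) → (Point → ℤ) → Set
  Spanℤ G f = ∃[ n ] Σ (Fin n → ℤ) λ c → Σ (Fin n → Point → ℤ) λ g →
    (∀ i → G (g i)) × (∀ x → f x ≡ sum (λ i → c i ℤ.* g i x))

  CylinderIndicator : (Point → ℤ) → Set
  CylinderIndicator g = ∃[ X ] IsCylinder X × g ≗ 𝟙 X

  ParallelLineDifference : (Point → ℤ) → Set
  ParallelLineDifference g = ∃[ ℓ₁ ] ∃[ ℓ₂ ]
    IsLine ℓ₁ × IsLine ℓ₂ × ℓ₁ ∥ ℓ₂ × (∀ x → g x ≡ 𝟙 ℓ₁ x ℤ.- 𝟙 ℓ₂ x)

{-# OPTIONS --safe #-}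

-- Summing 𝟙 S against powers of x₁ + αx₂ + βx₃ and interpolating in α and β, divisibility makes all moments of
-- 𝟙 S of degree at most p - 1 vanish modulo p. In the same way, the products (x₂ + αx₁)^m (x₃ + βx₁)^n with
-- m, n ≤ p - 1, not both p - 1, are modulo p combinations of differences of parallel lines, hence so is every
-- monomial of degree less than 2(p - 1) with exponents at most p - 1. The kernel ∏ᵢ ∏ₜ (vᵢ - wᵢ + t), where
-- 1 ≤ t ≤ p - 1, is a unit multiple of δ(v, w) modulo p, and each monomial of its expansion has degree at most
-- p - 1 in v or less than 2(p - 1) in w. So 𝟙 S is a combination of line differences modulo p. The same holds
-- for a plane H, hence 𝟙 S - 𝟙 H is a combination of line differences plus p m, where m has total 0. Finally
-- p (δᵥ - δᵤ), for v and u in a common plane, is the difference of the pencils of lines through v and u in that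
-- plane, so p m is itself a combination of line differences. A difference of parallel lines is a difference of
-- two cylinders that share their other lines.
module Submission where

open import Defs
open import Data.Bool.Base using (Bool; true; false; _∧_; if_then_else_)
open import Data.Fin.Base using (Fin; zero; suc; toℕ; fromℕ<; punchIn)
open import Data.Fin.Properties as Fin using (toℕ<n; toℕ-fromℕ<; toℕ-injective; punchInᵢ≢i)
open import Data.Integer.Base as ℤ using (ℤ; -[1+_]; 0ℤ; 1ℤ; _+_; _*_; _-_; -_) renaming (+_ to pos)
open import Data.Integer.Divisibility.Signed as ℤ∣ using (_∣_; divides; _∣?_; ∣ᵤ⇒∣; ∣⇒∣ᵤ)
import Data.Integer.DivMod as ℤ
open import Data.Integer.Properties as ℤ using (+-*-semiring; pos-+; pos-*; abs-*)
open import Data.Integer.Tactic.RingSolver using (solve-∀)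
open import Data.List.Base as List using (List; []; _∷_; _++_; filterᵇ; length; tabulate; cartesianProductWith)
open import Data.Nat.Base as ℕ using (ℕ; zero; suc; _≤_; _<_; z≤n; s≤s; _∸_; _^_)
import Data.Nat.Combinatorics as ℕ
import Data.Nat.Combinatorics.Specification as ℕ
open import Data.Nat.Coprimality using (Coprime; coprime-Bézout)
import Data.Nat.Divisibility as ℕ
import Data.Nat.DivMod as ℕ
open import Data.Nat.GCD using (module Bézout)
open import Data.Nat.Primality using (Prime; prime⇒nonZero; prime⇒nonTrivial; prime⇒irreducible; euclidsLemma)
import Data.Nat.Properties as ℕ
import Data.Nat.Tactic.RingSolver as ℕ-solver
open import Data.Product.Base using (Σ; ∃-syntax; _×_; _,_; proj₁; proj₂)
open import Data.Sum.Base using (_⊎_; inj₁; inj₂; [_,_]′)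
open import Data.Vec.Base as Vec using (Vec; []; _∷_)
open import Function.Base using (_∘_; id)
open import Function.Bundles using (_⇔_; mk⇔; Equivalence)
open import Relation.Binary.PropositionalEquality
open import Relation.Nullary using (¬_; Dec; yes; no; ⌊_⌋; contradiction)
import Algebra.Properties.CommutativeSemiring.Binomial ℤ.+-*-commutativeSemiring as Binomial
open import Algebra.Properties.CommutativeSemiring.Exp ℤ.+-*-commutativeSemiring using (^-distrib-*)
open import Algebra.Properties.Semiring.Exp +-*-semiring using (^-homo-*) renaming (_^_ to _^ᶻ_)
open import Algebra.Properties.Semiring.Mult +-*-semiring using () renaming (_×_ to infixr 8 _×ᶻ_)
open import Algebra.Properties.Semiring.Sum +-*-semiring
  using (sum; sum-remove; sum-cong-≗; ∑-distrib-+; *-distribˡ-sum; *-distribʳ-sum; sum-replicate-zero)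

-- Finite integer sums, rising factorials and filtered lists

sum-0 : ∀ {n} {g : Fin n → ℤ} → (∀ i → g i ≡ 0ℤ) → sum g ≡ 0ℤ
sum-0 {n} g≡0 = trans (sum-cong-≗ g≡0) (sum-replicate-zero n)

sum-minus : ∀ {n} (f g : Fin n → ℤ) → sum (λ i → f i - g i) ≡ sum f - sum g
sum-minus {zero}  f g = refl
sum-minus {suc n} f g = trans (cong (λ z → f zero - g zero + z) (sum-minus (f ∘ suc) (g ∘ suc)))
  (eq (f zero) (g zero) (sum (f ∘ suc)) (sum (g ∘ suc)))
  where
  eq : ∀ a b c d → (a - b) + (c - d) ≡ (a + c) - (b + d)
  eq = solve-∀

sum-const : ∀ n x → sum {n} (λ _ → x) ≡ pos n * x
sum-const zero    x = refl
sum-const (suc n) x = trans (cong (x +_) (sum-const n x)) (trans (eq x (pos n)) (cong (_* x) (sym (pos-+ 1 n))))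
  where
  eq : ∀ x n → x + n * x ≡ (1ℤ + n) * x
  eq = solve-∀

sum-telescope : ∀ n (F : ℕ → ℤ) → sum {n} (λ i → F (suc (toℕ i)) - F (toℕ i)) ≡ F n - F 0
sum-telescope zero    F = sym (ℤ.+-inverseʳ (F 0))
sum-telescope (suc n) F = trans (cong (λ z → (F 1 - F 0) + z) (sum-telescope n (F ∘ suc))) (eq (F 0) (F 1) (F (suc n)))
  where
  eq : ∀ a b c → (b - a) + (c - b) ≡ c - a
  eq = solve-∀

sum-split : ∀ {n} (g : Fin n → ℤ) i →
  ∃[ m ] Σ (Fin m → Fin n) λ other → (∀ j → other j ≢ i) × sum g ≡ g i + sum (g ∘ other)
sum-split {suc n} g i = n , punchIn i , (λ j → punchInᵢ≢i i j) , sum-remove {i = i} g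

sum-single : ∀ {n} (g : Fin n → ℤ) i → (∀ j → j ≢ i → g j ≡ 0ℤ) → sum g ≡ g i
sum-single g i g≡0 with sum-split g i
... | _ , other , other≢i , eq =
  trans eq (trans (cong (λ z → g i + z) (sum-0 (λ j → g≡0 (other j) (other≢i j)))) (ℤ.+-identityʳ (g i)))

-- The product (u + 1)(u + 2)⋯(u + n). For n = p - 1 it is nonzero modulo p exactly when u ≡ 0,
-- which makes it a kernel; for n < p - 1 its sum over a full period vanishes modulo p.
rising : ℕ → ℤ → ℤ
rising zero    u = 1ℤ
rising (suc n) u = rising n u * (u + pos (suc n))

-- The two products share the factors u + 2, ..., u + n + 1, and the remaining factors u + n + 2 and
-- u + 1 differ by n + 1. Sums of rising factorials therefore telescope.
rising-difference : ∀ n u → rising (suc n) (1ℤ + u) - rising (suc n) u ≡ pos (suc n) * rising n (1ℤ + u)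
rising-difference zero    u = eq u
  where
  eq : ∀ u → 1ℤ * (1ℤ + u + 1ℤ) - 1ℤ * (u + 1ℤ) ≡ 1ℤ * 1ℤ
  eq = solve-∀
rising-difference (suc n) u = begin
  r * b - s * a               ≡⟨ cong₂ (λ x y → r * x - s * y) b≡a+1 refl ⟩
  r * (a + 1ℤ) - s * a        ≡⟨ eq₁ r s a ⟩
  (r - s) * a + r             ≡⟨ cong₂ (λ d x → d * a + x) (rising-difference n u) refl ⟩
  pos (suc n) * q * a + r         ≡⟨ cong (λ x → pos (suc n) * q * x + r) a≡ ⟩
  pos (suc n) * q * (1ℤ + u + pos (suc n)) + r ≡⟨ eq₂ (pos (suc n)) q (1ℤ + u) ⟩
  (1ℤ + pos (suc n)) * r          ≡⟨ cong (_* r) (sym (pos-+ 1 (suc n))) ⟩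
  pos (suc (suc n)) * r           ∎
  where
  open ≡-Reasoning
  a = u + pos (suc (suc n))
  b = 1ℤ + u + pos (suc (suc n))
  q = rising n (1ℤ + u)
  r = rising (suc n) (1ℤ + u)
  s = rising (suc n) u
  b≡a+1 : b ≡ a + 1ℤ
  b≡a+1 = eq u (pos (suc (suc n)))
    where
    eq : ∀ u m → 1ℤ + u + m ≡ u + m + 1ℤ
    eq = solve-∀
  a≡ : a ≡ 1ℤ + u + pos (suc n)
  a≡ = trans (cong (λ z → u + z) (pos-+ 1 (suc n))) (eq u (pos (suc n)))
    where
    eq : ∀ u m → u + (1ℤ + m) ≡ 1ℤ + u + m
    eq = solve-∀
  eq₁ : ∀ r s a → r * (a + 1ℤ) - s * a ≡ (r - s) * a + r
  eq₁ = solve-∀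
  eq₂ : ∀ m q w → m * q * (w + m) + q * (w + m) ≡ (1ℤ + m) * (q * (w + m))
  eq₂ = solve-∀

×-pos : ∀ n x → n ×ᶻ x ≡ pos n * x
×-pos zero    x = refl
×-pos (suc n) x = trans (cong (x +_) (×-pos n x)) (trans (eq x (pos n)) (cong (_* x) (sym (pos-+ 1 n))))
  where
  eq : ∀ x n → x + n * x ≡ (1ℤ + n) * x
  eq = solve-∀

length-filter-++ : ∀ {A : Set} (X : A → Bool) xs ys →
  length (filterᵇ X (xs ++ ys)) ≡ length (filterᵇ X xs) ℕ.+ length (filterᵇ X ys)
length-filter-++ X []       ys = refl
length-filter-++ X (x ∷ xs) ys with X x
... | true  = cong suc (length-filter-++ X xs ys)
... | false = length-filter-++ X xs ys

length-filter-map : ∀ {A B : Set} (X : B → Bool) (f : A → B) xs →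
  length (filterᵇ X (List.map f xs)) ≡ length (filterᵇ (X ∘ f) xs)
length-filter-map X f []       = refl
length-filter-map X f (x ∷ xs) with X (f x)
... | true  = cong suc (length-filter-map X f xs)
... | false = length-filter-map X f xs

module PrimeModulus (p : ℕ) (p-prime : Prime p) where

  open AffineSpace p {{prime⇒nonZero p-prime}}

  private instance
    p-nonZero : ℕ.NonZero p
    p-nonZero = prime⇒nonZero p-prime
    p-nonTrivial : ℕ.NonTrivial p
    p-nonTrivial = prime⇒nonTrivial p-prime

  -- Arithmetic modulo p

  P : ℤ
  P = pos p

  infix 4 _≋_

  -- The quotient is kept as data because `resp-≋` gathers the quotients at all points into one
  -- function, which `multiple` absorbs.
  record _≋_ (x y : ℤ) : Set where
    constructor congruent
    field
      quotient : ℤ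
      equality : x ≡ y + P * quotient

  ≋-refl : ∀ {x} → x ≋ x
  ≋-refl {x} = congruent 0ℤ (eq x P)
    where
    eq : ∀ x P → x ≡ x + P * 0ℤ
    eq = solve-∀

  ≋-reflexive : ∀ {x y} → x ≡ y → x ≋ y
  ≋-reflexive refl = ≋-refl

  ≋-sym : ∀ {x y} → x ≋ y → y ≋ x
  ≋-sym {_} {y} (congruent q refl) = congruent (- q) (eq y P q)
    where
    eq : ∀ y P q → y ≡ y + P * q + P * - q
    eq = solve-∀

  ≋-trans : ∀ {x y z} → x ≋ y → y ≋ z → x ≋ z
  ≋-trans {z = z} (congruent q refl) (congruent r refl) = congruent (q + r) (eq z P q r)
    where
    eq : ∀ z P q r → z + P * r + P * q ≡ z + P * (q + r)
    eq = solve-∀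

  +-cong-≋ : ∀ {x y u v} → x ≋ y → u ≋ v → x + u ≋ y + v
  +-cong-≋ {_} {y} {_} {v} (congruent q refl) (congruent r refl) = congruent (q + r) (eq y v P q r)
    where
    eq : ∀ y v P q r → y + P * q + (v + P * r) ≡ y + v + P * (q + r)
    eq = solve-∀

  *-cong-≋ : ∀ {x y u v} → x ≋ y → u ≋ v → x * u ≋ y * v
  *-cong-≋ {_} {y} {_} {v} (congruent q refl) (congruent r refl) =
    congruent (q * v + y * r + P * q * r) (eq y v P q r)
    where
    eq : ∀ y v P q r → (y + P * q) * (v + P * r) ≡ y * v + P * (q * v + y * r + P * q * r)
    eq = solve-∀

  neg-cong-≋ : ∀ {x y} → x ≋ y → - x ≋ - y
  neg-cong-≋ {_} {y} (congruent q refl) = congruent (- q) (eq y P q)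
    where
    eq : ∀ y P q → - (y + P * q) ≡ - y + P * - q
    eq = solve-∀

  ^-cong-≋ : ∀ {x y} n → x ≋ y → x ^ᶻ n ≋ y ^ᶻ n
  ^-cong-≋ zero    x≋y = ≋-refl
  ^-cong-≋ (suc n) x≋y = *-cong-≋ x≋y (^-cong-≋ n x≋y)

  ∣⇒≋0 : ∀ {x} → P ∣ x → x ≋ 0ℤ
  ∣⇒≋0 (divides q refl) = congruent q (eq q P)
    where
    eq : ∀ q P → q * P ≡ 0ℤ + P * q
    eq = solve-∀

  ≋0⇒∣ : ∀ {x} → x ≋ 0ℤ → P ∣ x
  ≋0⇒∣ (congruent q refl) = divides q (eq q P)
    where
    eq : ∀ q P → 0ℤ + P * q ≡ q * P
    eq = solve-∀

  ∣-resp-≋ : ∀ {x y} → x ≋ y → P ∣ x → P ∣ y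
  ∣-resp-≋ x≋y P∣x = ≋0⇒∣ (≋-trans (≋-sym x≋y) (∣⇒≋0 P∣x))

  ∣-⇒≋ : ∀ x y → P ∣ x - y → x ≋ y
  ∣-⇒≋ x y P∣x-y = ≋-trans (≋-reflexive (eq x y)) (≋-trans (+-cong-≋ (∣⇒≋0 P∣x-y) ≋-refl) (≋-reflexive (ℤ.+-identityˡ y)))
    where
    eq : ∀ x y → x ≡ x - y + y
    eq = solve-∀

  ≋⇒∣- : ∀ {x y} → x ≋ y → P ∣ x - y
  ≋⇒∣- {x} {y} x≋y = ∣-resp-≋ (+-cong-≋ (≋-sym x≋y) (≋-refl { - y})) (≋0⇒∣ (≋-reflexive (ℤ.+-inverseʳ y)))

  ∣-sum : ∀ {n} {g : Fin n → ℤ} → (∀ i → P ∣ g i) → P ∣ sum g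
  ∣-sum {zero}  P∣g = divides 0ℤ refl
  ∣-sum {suc n} P∣g = ℤ∣.∣m∣n⇒∣m+n (P∣g zero) (∣-sum (P∣g ∘ suc))

  sum-single-≋ : ∀ {n} (g : Fin n → ℤ) i → (∀ j → j ≢ i → P ∣ g j) → sum g ≋ g i
  sum-single-≋ g i P∣g with sum-split g i
  ... | _ , other , other≢i , eq =
    ≋-trans (≋-reflexive eq)
      (≋-trans (+-cong-≋ (≋-refl {g i}) (∣⇒≋0 (∣-sum (λ j → P∣g (other j) (other≢i j))))) (≋-reflexive (ℤ.+-identityʳ (g i))))

  euclid : ∀ x y → P ∣ x * y → P ∣ x ⊎ P ∣ y
  euclid x y P∣xy with euclidsLemma ℤ.∣ x ∣ ℤ.∣ y ∣ p-prime (subst (p ℕ.∣_) (abs-* x y) (∣⇒∣ᵤ P∣xy))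
  ... | inj₁ p∣x = inj₁ (∣ᵤ⇒∣ p∣x)
  ... | inj₂ p∣y = inj₂ (∣ᵤ⇒∣ p∣y)

  ∤-* : ∀ x y → ¬ P ∣ x → ¬ P ∣ y → ¬ P ∣ x * y
  ∤-* x y ∤x ∤y ∣xy = [ ∤x , ∤y ]′ (euclid x y ∣xy)

  ∤-small : ∀ {n} → suc n < p → ¬ P ∣ pos (suc n)
  ∤-small n<p P∣n = ℕ.>⇒∤ n<p (∣⇒∣ᵤ P∣n)

  inverse-pos : ∀ n → ¬ P ∣ pos n → ∃[ c ] pos n * c ≋ 1ℤ
  inverse-pos n P∤n with coprime-Bézout coprime
    where
    coprime : Coprime p n
    coprime (d∣p , d∣n) with prime⇒irreducible p-prime d∣p
    ... | inj₁ d≡1  = d≡1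
    ... | inj₂ refl = contradiction (∣ᵤ⇒∣ d∣n) P∤n
  -- Here 1 + y n = x p, so the inverse is -y; in the other case 1 + x p = y n and it is y.
  ... | Bézout.+- x y eq = - pos y , congruent (- pos x) (begin
      pos n * - pos y            ≡⟨ eq₁ (pos n) (pos y) ⟩
      1ℤ - (1ℤ + pos y * pos n)  ≡⟨ cong (λ z → 1ℤ - (1ℤ + z)) (sym (pos-* y n)) ⟩
      1ℤ - (1ℤ + pos (y ℕ.* n))  ≡⟨ cong (λ z → 1ℤ - z) (sym (pos-+ 1 (y ℕ.* n))) ⟩
      1ℤ - pos (1 ℕ.+ y ℕ.* n)   ≡⟨ cong (λ z → 1ℤ - pos z) eq ⟩
      1ℤ - pos (x ℕ.* p)         ≡⟨ cong (λ z → 1ℤ - z) (pos-* x p) ⟩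
      1ℤ - pos x * P             ≡⟨ eq₂ (pos x) P ⟩
      1ℤ + P * - pos x           ∎)
    where
    open ≡-Reasoning
    eq₁ : ∀ n y → n * - y ≡ 1ℤ - (1ℤ + y * n)
    eq₁ = solve-∀
    eq₂ : ∀ x P → 1ℤ - x * P ≡ 1ℤ + P * - x
    eq₂ = solve-∀
  ... | Bézout.-+ x y eq = pos y , congruent (pos x) (begin
      pos n * pos y        ≡⟨ ℤ.*-comm (pos n) (pos y) ⟩
      pos y * pos n        ≡⟨ sym (pos-* y n) ⟩
      pos (y ℕ.* n)      ≡⟨ cong pos (sym eq) ⟩
      pos (1 ℕ.+ x ℕ.* p) ≡⟨ pos-+ 1 (x ℕ.* p) ⟩
      1ℤ + pos (x ℕ.* p) ≡⟨ cong (1ℤ +_) (pos-* x p) ⟩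
      1ℤ + pos x * P     ≡⟨ cong (1ℤ +_) (ℤ.*-comm (pos x) P) ⟩
      1ℤ + P * pos x     ∎)
    where open ≡-Reasoning

  inverse : ∀ x → ¬ P ∣ x → ∃[ c ] x * c ≋ 1ℤ
  inverse (pos n)      P∤x = inverse-pos n P∤x
  inverse (-[1+ n ]) P∤x with inverse-pos (suc n) (P∤x ∘ ℤ∣.∣m⇒∣-m)
  ... | c , eq = - c , ≋-trans (≋-reflexive (double-neg (pos (suc n)) c)) eq
    where
    double-neg : ∀ x c → - x * - c ≡ x * c
    double-neg = solve-∀

  -- Residues and the indicator of divisibility by p

  ι : Fin p → ℤ
  ι a = pos (toℕ a)

  ρ : ℤ → Fin p
  ρ x = fromℕ< (ℤ.n%ℕd<d x p)

  ι-ρ : ∀ x → ι (ρ x) ≋ x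
  ι-ρ x = ≋-sym (congruent (x ℤ./ℕ p)
    (trans (ℤ.a≡a%ℕn+[a/ℕn]*n x p)
      (cong₂ _+_ (cong pos (sym (toℕ-fromℕ< (ℤ.n%ℕd<d x p)))) (ℤ.*-comm (x ℤ./ℕ p) P))))

  ι-injective : ∀ {a b} → ι a ≋ ι b → a ≡ b
  ι-injective {a} {b} a≋b = toℕ-injective (ℤ.+-injective (ℤ.i-j≡0⇒i≡j (ι a) (ι b) (ℤ.∣i∣≡0⇒i≡0 (difference≡0 _ small (∣⇒∣ᵤ (≋⇒∣- a≋b))))))
    where
    small : ℤ.∣ ι a - ι b ∣ < p
    small = subst (_< p) (cong ℤ.∣_∣ (sym (ℤ.m-n≡m⊖n (toℕ a) (toℕ b))))
      (ℕ.≤-<-trans (ℤ.∣m⊝n∣≤m⊔n (toℕ a) (toℕ b)) (ℕ.⊔-lub (toℕ<n a) (toℕ<n b)))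
    difference≡0 : ∀ n → n < p → p ℕ.∣ n → n ≡ 0
    difference≡0 zero    _   _   = refl
    difference≡0 (suc n) n<p p∣n = contradiction p∣n (ℕ.>⇒∤ n<p)

  ρ-cong : ∀ {x y} → x ≋ y → ρ x ≡ ρ y
  ρ-cong {x} {y} x≋y = ι-injective (≋-trans (ι-ρ x) (≋-trans x≋y (≋-sym (ι-ρ y))))

  ρ-ι : ∀ a → ρ (ι a) ≡ a
  ρ-ι a = ι-injective (ι-ρ (ι a))

  ε : ℤ → ℤ
  ε x = if ⌊ P ∣? x ⌋ then 1ℤ else 0ℤ

  ε-yes : ∀ {x} → P ∣ x → ε x ≡ 1ℤ
  ε-yes {x} P∣x with P ∣? x
  ... | yes _  = refl
  ... | no P∤x = contradiction P∣x P∤x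

  ε-no : ∀ {x} → ¬ P ∣ x → ε x ≡ 0ℤ
  ε-no {x} P∤x with P ∣? x
  ... | yes P∣x = contradiction P∣x P∤x
  ... | no _    = refl

  ε-iff : ∀ {x y} → (P ∣ x → P ∣ y) → (P ∣ y → P ∣ x) → ε x ≡ ε y
  ε-iff {x} {y} to from with P ∣? y
  ... | yes P∣y = ε-yes (from P∣y)
  ... | no P∤y  = ε-no (P∤y ∘ to)

  ε-cong : ∀ {x y} → x ≋ y → ε x ≡ ε y
  ε-cong x≋y = ε-iff (∣-resp-≋ x≋y) (∣-resp-≋ (≋-sym x≋y))

  sum-ε : ∀ x (F : Fin p → ℤ) → sum (λ r → F r * ε (x - ι r)) ≡ F (ρ x)
  sum-ε x F = trans (sum-single _ (ρ x) off) (trans (cong (F (ρ x) *_) (ε-yes (≋⇒∣- (≋-sym (ι-ρ x))))) (ℤ.*-identityʳ _))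
    where
    off : ∀ r → r ≢ ρ x → F r * ε (x - ι r) ≡ 0ℤ
    off r r≢ = trans (cong (F r *_) (ε-no λ P∣ → r≢ (trans (sym (ρ-ι r)) (sym (ρ-cong (∣-⇒≋ x (ι r) P∣)))))) (ℤ.*-zeroʳ (F r))

  sum-ε-1 : ∀ x → sum (λ r → ε (x - ι r)) ≡ 1ℤ
  sum-ε-1 x = trans (sum-cong-≗ (λ r → sym (ℤ.*-identityˡ (ε (x - ι r))))) (sum-ε x (λ _ → 1ℤ))

  n!-indivisible : ∀ n → n < p → ¬ P ∣ pos (n ℕ.!)
  n!-indivisible zero    _   P∣1 = ℕ.>⇒∤ (ℕ.nonTrivial⇒n>1 p) (∣⇒∣ᵤ P∣1)
  n!-indivisible (suc n) n<p = subst (λ z → ¬ P ∣ z) (sym (pos-* (suc n) (n ℕ.!)))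
    (∤-* (pos (suc n)) (pos (n ℕ.!)) (∤-small n<p) (n!-indivisible n (ℕ.<-trans (ℕ.n<1+n n) n<p)))

  -- It divides m!, which is prime to p because m < p.
  C-indivisible : ∀ {m k} → m < p → k ≤ m → ¬ P ∣ pos (m ℕ.C k)
  C-indivisible {m} {k} m<p k≤m P∣C = n!-indivisible m m<p
    (∣ᵤ⇒∣ (subst (p ℕ.∣_) (ℕ.m/n*n≡m (ℕ.k![n∸k]!∣n! k≤m)) (ℕ.∣m⇒∣m*n _ (subst (p ℕ.∣_) (ℕ.nCk≡n!/k![n-k]! k≤m) (∣⇒∣ᵤ P∣C)))))
    where instance _ = (k ℕ.!* (m ∸ k) !≢0)

  -- Polynomial identities modulo p

  -- Such a K is the preimage of a subspace of the functions into 𝔽_p: by `multiple`, membership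
  -- depends only on residues. The polynomial arguments below are made once for an arbitrary K and
  -- then used for divisible sums, moments, combinations of line differences and kernels.
  record IsSubmodule {X : Set} (K : (X → ℤ) → Set) : Set where
    field
      respects     : ∀ {f g} → f ≗ g → K f → K g
      add      : ∀ {f g} → K f → K g → K (λ x → f x + g x)
      scale    : ∀ c {f} → K f → K (λ x → c * f x)
      multiple : ∀ f → K (λ x → P * f x)

    resp-≋ : ∀ {f g} → (∀ x → f x ≋ g x) → K f → K g
    resp-≋ {f} {g} f≋g Kf = respects (λ x → sym (_≋_.equality (≋-sym (f≋g x))))
      (add Kf (multiple (λ x → _≋_.quotient (≋-sym (f≋g x)))))

    null : ∀ {f} → (∀ x → P ∣ f x) → K f
    null P∣f = resp-≋ (λ x → ≋-sym (≋-trans (∣⇒≋0 (P∣f x)) (≋-reflexive (sym (ℤ.*-zeroʳ P))))) (multiple (λ _ → 0ℤ))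

    subtract : ∀ {f g} → K f → K g → K (λ x → f x - g x)
    subtract {f} {g} Kf Kg = respects (λ x → eq (f x) (g x)) (add Kf (scale (- 1ℤ) Kg))
      where
      eq : ∀ a b → a + - 1ℤ * b ≡ a - b
      eq = solve-∀

    sum-closed : ∀ {n} {g : Fin n → X → ℤ} → (∀ i → K (g i)) → K (λ x → sum (λ i → g i x))
    sum-closed {zero}  Kg = null (λ _ → divides 0ℤ refl)
    sum-closed {suc n} Kg = add (Kg zero) (sum-closed (Kg ∘ suc))

    cancel : ∀ c {f} → ¬ P ∣ c → K (λ x → c * f x) → K f
    cancel c {f} P∤c Kcf with inverse c P∤c
    ... | d , cd≋1 = resp-≋ (λ x → ≋-trans (≋-reflexive (eq c d (f x)))
        (≋-trans (*-cong-≋ cd≋1 ≋-refl) (≋-reflexive (ℤ.*-identityˡ (f x))))) (scale d Kcf)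
      where
      eq : ∀ c d y → d * (c * y) ≡ c * d * y
      eq = solve-∀

    evaluate : ∀ n → (Fin n → X → ℤ) → ℤ → X → ℤ
    evaluate zero    c t x = 0ℤ
    evaluate (suc n) c t x = c zero x + t * evaluate n (c ∘ suc) t x

    -- The coefficients of (c(t) - c(a)) / (t - a) by synthetic division.
    quotientAt : ∀ n → (Fin (suc n) → X → ℤ) → ℤ → Fin n → X → ℤ
    quotientAt (suc n) c a zero    = evaluate (suc n) (c ∘ suc) a
    quotientAt (suc n) c a (suc i) = quotientAt n (c ∘ suc) a i

    quotientAt-correct : ∀ n c a t x →
      (t - a) * evaluate n (quotientAt n c a) t x ≡ evaluate (suc n) c t x - evaluate (suc n) c a x
    quotientAt-correct zero    c a t x = eq (c zero x) a t
      where
      eq : ∀ c a t → (t - a) * 0ℤ ≡ c + t * 0ℤ - (c + a * 0ℤ)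
      eq = solve-∀
    quotientAt-correct (suc n) c a t x = begin
      (t - a) * (ra + t * q)       ≡⟨ eq₁ a t ra q ⟩
      t * ((t - a) * q) + (t - a) * ra ≡⟨ cong (λ z → t * z + (t - a) * ra) (quotientAt-correct n (c ∘ suc) a t x) ⟩
      t * (rt - ra) + (t - a) * ra ≡⟨ eq₂ a t ra rt (c zero x) ⟩
      c zero x + t * rt - (c zero x + a * ra) ∎
      where
      open ≡-Reasoning
      ra = evaluate (suc n) (c ∘ suc) a x
      rt = evaluate (suc n) (c ∘ suc) t x
      q = evaluate n (quotientAt n (c ∘ suc) a) t x
      eq₁ : ∀ a t ra q → (t - a) * (ra + t * q) ≡ t * ((t - a) * q) + (t - a) * ra
      eq₁ = solve-∀
      eq₂ : ∀ a t ra rt c → t * (rt - ra) + (t - a) * ra ≡ c + t * rt - (c + a * ra)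
      eq₂ = solve-∀

    -- Synthetic division run backwards. The constant coefficient of the quotient is the value at a
    -- of the polynomial with coefficients `c ∘ suc`; subtracting a times it from c(a) leaves the
    -- constant coefficient of c, and the recursion continues from that value.
    from-quotient : ∀ n c a → K (evaluate (suc n) c a) → (∀ i → K (quotientAt n c a i)) → ∀ i → K (c i)
    from-quotient zero    c a Kc Kq zero    = respects (λ x → eq (c zero x) a) Kc
      where
      eq : ∀ c a → c + a * 0ℤ ≡ c
      eq = solve-∀
    from-quotient (suc n) c a Kc Kq zero    =
      respects (λ x → eq (c zero x) a (evaluate (suc n) (c ∘ suc) a x)) (subtract Kc (scale a (Kq zero)))
      where
      eq : ∀ c a r → c + a * r - a * r ≡ c
      eq = solve-∀
    from-quotient (suc n) c a Kc Kq (suc i) = from-quotient n (c ∘ suc) a (Kq zero) (Kq ∘ suc) i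

    -- Divide by t - a and recurse on the nodes a + 1, a + 2, ..., where the quotient is (c(t) -
    -- c(a)) / (t - a). The bound n ≤ p keeps the nodes distinct modulo p, so every t - a is a unit.
    interpolation : ∀ n a c → n ≤ p → (∀ k → k < n → K (evaluate n c (pos (a ℕ.+ k)))) → ∀ i → K (c i)
    interpolation (suc n) a c n<p Kc = from-quotient n c (pos a) Kca
      (interpolation n (suc a) (quotientAt n c (pos a)) (ℕ.<⇒≤ n<p) λ k k<n →
        cancel (pos (suc k)) (∤-small (ℕ.<-≤-trans (s≤s k<n) n<p))
          (respects (λ x → trans (sym (quotientAt-correct n c (pos a) (pos (suc a ℕ.+ k)) x)) (cong (_* evaluate n (quotientAt n c (pos a)) (pos (suc a ℕ.+ k)) x) (step k)))
            (subtract (subst (λ b → K (evaluate (suc n) c (pos b))) (ℕ.+-suc a k) (Kc (suc k) (s≤s k<n))) Kca)))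
      where
      Kca : K (evaluate (suc n) c (pos a))
      Kca = subst (λ b → K (evaluate (suc n) c (pos b))) (ℕ.+-identityʳ a) (Kc 0 (s≤s z≤n))
      step : ∀ k → pos (suc a ℕ.+ k) - pos a ≡ pos (suc k)
      step k = trans (cong (λ b → pos b - pos a) (sym (ℕ.+-suc a k)))
        (trans (cong (_- pos a) (pos-+ a (suc k))) (eq (pos a) (pos (suc k))))
        where
        eq : ∀ a b → a + b - a ≡ b
        eq = solve-∀

    evaluate-sum : ∀ n c t x → evaluate n c t x ≡ sum {n} (λ k → t ^ᶻ toℕ k * c k x)
    evaluate-sum zero    c t x = refl
    evaluate-sum (suc n) c t x = cong₂ _+_ (sym (ℤ.*-identityˡ (c zero x)))
      (trans (cong (t *_) (evaluate-sum n (c ∘ suc) t x))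
        (trans (*-distribˡ-sum t (λ k → t ^ᶻ toℕ k * c (suc k) x))
          (sum-cong-≗ λ k → sym (ℤ.*-assoc t (t ^ᶻ toℕ k) (c (suc k) x)))))

    -- The coefficient of t^j in (g + t h)^(i + j) e, recovered from the values at p points t.
    extract-coefficient : ∀ {g h e : X → ℤ} i j → i ℕ.+ j < p → (∀ t → K (λ x → (g x + pos t * h x) ^ᶻ (i ℕ.+ j) * e x)) →
      K (λ x → g x ^ᶻ i * h x ^ᶻ j * e x)
    extract-coefficient {g} {h} {e} i j m<p Kpow = respects reindexed
      -- The coefficient of t^j is the wanted product times the binomial coefficient of m over j, a
      -- unit since m < p.
      (cancel (pos (m ℕ.C toℕ k)) (C-indivisible m<p (ℕ.<⇒≤pred (toℕ<n k)))
        (interpolation (suc m) 0 coefficient m<p (λ t _ → respects (expansion t) (Kpow t)) k))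
      where
      m = i ℕ.+ j
      k : Fin (suc m)
      k = fromℕ< (s≤s (ℕ.m≤n+m j i))
      monomial : Fin (suc m) → X → ℤ
      monomial k x = h x ^ᶻ toℕ k * g x ^ᶻ (m ∸ toℕ k) * e x
      coefficient : Fin (suc m) → X → ℤ
      coefficient k x = pos (m ℕ.C toℕ k) * monomial k x
      reindexed : ∀ x → monomial k x ≡ g x ^ᶻ i * h x ^ᶻ j * e x
      reindexed x = cong (_* e x) (trans (cong₂ (λ a b → h x ^ᶻ a * g x ^ᶻ b) k≡j (trans (cong (m ∸_) k≡j) (ℕ.m+n∸n≡m i j)))
        (ℤ.*-comm (h x ^ᶻ j) (g x ^ᶻ i)))
        where
        k≡j = toℕ-fromℕ< (s≤s (ℕ.m≤n+m j i))
      term : ∀ t x k → Binomial.binomialTerm (pos t * h x) (g x) m k * e x ≡ pos t ^ᶻ toℕ k * coefficient k x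
      term t x k = begin
        (m ℕ.C toℕ k) ×ᶻ ((pos t * h x) ^ᶻ toℕ k * G) * e x    ≡⟨ cong (_* e x) (×-pos (m ℕ.C toℕ k) _) ⟩
        c * ((pos t * h x) ^ᶻ toℕ k * G) * e x                 ≡⟨ cong (λ z → c * (z * G) * e x) (^-distrib-* (pos t) (h x) (toℕ k)) ⟩
        c * (pos t ^ᶻ toℕ k * h x ^ᶻ toℕ k * G) * e x          ≡⟨ eq c (pos t ^ᶻ toℕ k) (h x ^ᶻ toℕ k) G (e x) ⟩
        pos t ^ᶻ toℕ k * coefficient k x                       ∎
        where
        open ≡-Reasoning
        c = pos (m ℕ.C toℕ k)
        G = g x ^ᶻ (m ∸ toℕ k)
        eq : ∀ c t h g e → c * (t * h * g) * e ≡ t * (c * (h * g * e))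
        eq = solve-∀
      expansion : ∀ t x → (g x + pos t * h x) ^ᶻ m * e x ≡ evaluate (suc m) coefficient (pos t) x
      expansion t x = begin
        (g x + pos t * h x) ^ᶻ m * e x       ≡⟨ cong (λ z → z ^ᶻ m * e x) (ℤ.+-comm (g x) (pos t * h x)) ⟩
        (pos t * h x + g x) ^ᶻ m * e x       ≡⟨ cong (_* e x) (Binomial.theorem m (pos t * h x) (g x)) ⟩
        sum (Binomial.binomialTerm (pos t * h x) (g x) m) * e x ≡⟨ *-distribʳ-sum (e x) (Binomial.binomialTerm (pos t * h x) (g x) m) ⟩
        sum (λ k → Binomial.binomialTerm (pos t * h x) (g x) m k * e x) ≡⟨ sum-cong-≗ (term t x) ⟩
        sum (λ k → pos t ^ᶻ toℕ k * coefficient k x) ≡⟨ sym (evaluate-sum (suc m) coefficient (pos t) x) ⟩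
        evaluate (suc m) coefficient (pos t) x ∎
        where open ≡-Reasoning

    -- Induction on the factors: the last one, x - y + n, goes into the weight e, and multiplying a
    -- monomial by it raises the degree by at most one. The free weight also lets the three
    -- coordinates be expanded one after another.
    rising-from-monomials : ∀ n {x y e : X → ℤ} →
      (∀ i j → i ℕ.+ j ≤ n → K (λ v → x v ^ᶻ i * y v ^ᶻ j * e v)) → K (λ v → rising n (x v - y v) * e v)
    rising-from-monomials zero    {x} {y} {e} Kmon = respects (λ v → eq (e v)) (Kmon 0 0 z≤n)
      where
      eq : ∀ e → 1ℤ * 1ℤ * e ≡ 1ℤ * e
      eq = solve-∀
    rising-from-monomials (suc n) {x} {y} {e} Kmon =
      respects (λ v → sym (ℤ.*-assoc (rising n (x v - y v)) (x v - y v + s) (e v)))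
        (rising-from-monomials n {e = λ v → (x v - y v + s) * e v} λ i j i+j≤n →
          respects (λ v → eq (x v) (y v) (x v ^ᶻ i) (y v ^ᶻ j) s (e v))
            (add (subtract (Kmon (suc i) j (s≤s i+j≤n))
                           (Kmon i (suc j) (subst (_≤ suc n) (sym (ℕ.+-suc i j)) (s≤s i+j≤n))))
                 (scale s (Kmon i j (ℕ.m≤n⇒m≤1+n i+j≤n)))))
      where
      s = pos (suc n)
      eq : ∀ x y a b s e → x * a * b * e - a * (y * b) * e + s * (a * b * e) ≡ a * b * ((x - y + s) * e)
      eq = solve-∀

    -- Since x times `rising n x` is `rising (suc n) x` minus (n + 1) times `rising n x`, the
    -- factors x can be traded one by one for longer rising factorials.
    monomials-from-rising : ∀ m {x e : X → ℤ} → (∀ n → n ≤ m → K (λ v → rising n (x v) * e v)) →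
      K (λ v → x v ^ᶻ m * e v)
    monomials-from-rising m {x} {e} Krise = respects (λ v → cong (x v ^ᶻ m *_) (ℤ.*-identityˡ (e v))) (mixed m 0 (ℕ.≤-reflexive (ℕ.+-identityʳ m)))
      where
      mixed : ∀ i n → i ℕ.+ n ≤ m → K (λ v → x v ^ᶻ i * (rising n (x v) * e v))
      mixed zero    n n≤m = respects (λ v → sym (ℤ.*-identityˡ _)) (Krise n n≤m)
      mixed (suc i) n i+n<m = respects (λ v → eq (x v) (x v ^ᶻ i) (rising n (x v)) (pos (suc n)) (e v))
        (subtract (mixed i (suc n) (subst (_≤ m) (sym (ℕ.+-suc i n)) i+n<m))
          (scale (pos (suc n)) (mixed i n (ℕ.<⇒≤ i+n<m))))
        where
        eq : ∀ x a r s e → a * (r * (x + s) * e) - s * (a * (r * e)) ≡ x * a * (r * e)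
        eq = solve-∀

  -- Power sums modulo p

  rising-divisible : ∀ n u k → k < n → P ∣ u + pos (suc k) → P ∣ rising n u
  rising-divisible (suc n) u k (s≤s k≤n) P∣ with ℕ.m≤n⇒m<n∨m≡n k≤n
  ... | inj₁ k<n  = ℤ∣.∣m⇒∣m*n _ (rising-divisible n u k k<n P∣)
  ... | inj₂ refl = ℤ∣.∣n⇒∣m*n (rising n u) P∣

  divisibleSum : ∀ n → IsSubmodule {Fin n} (λ h → P ∣ sum h)
  divisibleSum n = record
    { respects     = λ f≗g → subst (P ∣_) (sum-cong-≗ f≗g)
    ; add      = λ {f} {g} P∣f P∣g → subst (P ∣_) (sym (∑-distrib-+ f g)) (ℤ∣.∣m∣n⇒∣m+n P∣f P∣g)
    ; scale    = λ c {f} P∣f → subst (P ∣_) (*-distribˡ-sum c f) (ℤ∣.∣n⇒∣m*n c P∣f)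
    ; multiple = λ f → subst (P ∣_) (*-distribˡ-sum P f) (ℤ∣.∣m⇒∣m*n _ ℤ∣.∣-refl)
    }

  -- Rewrite r^m through the `rising n r` with n ≤ m. Up to the factor n + 1, a unit because n + 1 <
  -- p, each of them is a difference of consecutive values of `rising (suc n)`, so its sum
  -- telescopes.
  power-sum-divisible : ∀ m → suc m < p → P ∣ sum (λ r → ι r ^ᶻ m)
  power-sum-divisible m m+1<p = subst (P ∣_) (sum-cong-≗ λ r → ℤ.*-identityʳ (ι r ^ᶻ m))
    (monomials-from-rising m {ι} {λ _ → 1ℤ} λ n n≤m →
      respects (λ r → sym (ℤ.*-identityʳ _)) (cancel (pos (suc n)) (∤-small (ℕ.≤-<-trans (s≤s n≤m) m+1<p))
        (subst (P ∣_) (trans (sym (sum-telescope p (λ k → rising (suc n) (pos k - 1ℤ)))) (sum-cong-≗ λ r → difference n (ι r) (pos-+ 1 (toℕ r))))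
          -- Both ends vanish modulo p: the first factor u + 1 is p at u = p - 1 and 0 at u = -1.
          (ℤ∣.∣m∣n⇒∣m-n (rising-divisible (suc n) (P - 1ℤ) 0 (s≤s z≤n) (subst (P ∣_) (sym (eq P)) ℤ∣.∣-refl))
                         (rising-divisible (suc n) (0ℤ - 1ℤ) 0 (s≤s z≤n) (divides 0ℤ refl))))))
    where
    open IsSubmodule (divisibleSum p)
    eq : ∀ P → P - 1ℤ + 1ℤ ≡ P
    eq = solve-∀
    difference : ∀ n r {s} → s ≡ 1ℤ + r → rising (suc n) (s - 1ℤ) - rising (suc n) (r - 1ℤ) ≡ pos (suc n) * rising n r
    difference n r refl = trans (cong (λ z → rising (suc n) z - rising (suc n) (r - 1ℤ)) (eq₁ r))
      (trans (rising-difference n (r - 1ℤ)) (cong (λ z → pos (suc n) * rising n z) (eq₂ r)))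
      where
      eq₁ : ∀ r → 1ℤ + r - 1ℤ ≡ 1ℤ + (r - 1ℤ)
      eq₁ = solve-∀
      eq₂ : ∀ r → 1ℤ + (r - 1ℤ) ≡ r
      eq₂ = solve-∀

  ε-neg : ∀ x → ε (- x) ≡ ε x
  ε-neg x = ε-iff (λ P∣ → subst (P ∣_) (ℤ.neg-involutive x) (ℤ∣.∣m⇒∣-m P∣)) ℤ∣.∣m⇒∣-m

  sum-ε-shift : ∀ d s → sum (λ c → ε (ι c + d - s)) ≡ 1ℤ
  sum-ε-shift d s = trans (sum-cong-≗ λ c → trans (sym (ε-neg (ι c + d - s))) (cong ε (eq (ι c) d s))) (sum-ε-1 (s - d))
    where
    eq : ∀ c d s → - (c + d - s) ≡ s - d - c
    eq = solve-∀

  sum-ε-at : ∀ s → sum (λ c → ε (ι c - s)) ≡ 1ℤ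
  sum-ε-at s = trans (sum-cong-≗ λ c → cong (λ z → ε (z - s)) (sym (ℤ.+-identityʳ (ι c)))) (sum-ε-shift 0ℤ s)

  ι-mod : ∀ n → ι (n ℕ.mod p) ≋ pos n
  ι-mod n = ≋-sym (congruent (pos (n ℕ./ p)) (begin
    pos n                                      ≡⟨ cong pos (ℕ.m≡m%n+[m/n]*n n p) ⟩
    pos (n ℕ.% p ℕ.+ n ℕ./ p ℕ.* p)            ≡⟨ pos-+ (n ℕ.% p) (n ℕ./ p ℕ.* p) ⟩
    pos (n ℕ.% p) + pos (n ℕ./ p ℕ.* p)        ≡⟨ cong₂ _+_ (cong pos (sym (toℕ-fromℕ< (ℕ.m%n<n n p)))) (trans (pos-* (n ℕ./ p) p) (ℤ.*-comm _ P)) ⟩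
    ι (n ℕ.mod p) + P * pos (n ℕ./ p)          ∎))
    where open ≡-Reasoning

  ι-+ : ∀ a b → ι (a +𝔽 b) ≋ ι a + ι b
  ι-+ a b = ≋-trans (ι-mod (toℕ a ℕ.+ toℕ b)) (≋-reflexive (pos-+ (toℕ a) (toℕ b)))

  ι-* : ∀ a b → ι (a *𝔽 b) ≋ ι a * ι b
  ι-* a b = ≋-trans (ι-mod (toℕ a ℕ.* toℕ b)) (≋-reflexive (pos-* (toℕ a) (toℕ b)))

  ι-0 : ι 0𝔽 ≋ 0ℤ
  ι-0 = ι-mod 0

  -- Sums over all vectors

  sumᵥ : ∀ n → (Vec 𝔽 n → ℤ) → ℤ
  sumᵥ zero    g = g []
  sumᵥ (suc n) g = sum λ a → sumᵥ n λ v → g (a ∷ v)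

  sumᵥ-cong : ∀ n {f g} → (∀ v → f v ≡ g v) → sumᵥ n f ≡ sumᵥ n g
  sumᵥ-cong zero    f≗g = f≗g []
  sumᵥ-cong (suc n) f≗g = sum-cong-≗ λ a → sumᵥ-cong n λ v → f≗g (a ∷ v)

  sumᵥ-+ : ∀ n f g → sumᵥ n (λ v → f v + g v) ≡ sumᵥ n f + sumᵥ n g
  sumᵥ-+ zero    f g = refl
  sumᵥ-+ (suc n) f g = trans (sum-cong-≗ λ a → sumᵥ-+ n (λ v → f (a ∷ v)) (λ v → g (a ∷ v)))
    (∑-distrib-+ (λ a → sumᵥ n λ v → f (a ∷ v)) (λ a → sumᵥ n λ v → g (a ∷ v)))

  sumᵥ-*ˡ : ∀ n c f → sumᵥ n (λ v → c * f v) ≡ c * sumᵥ n f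
  sumᵥ-*ˡ zero    c f = refl
  sumᵥ-*ˡ (suc n) c f = trans (sum-cong-≗ λ a → sumᵥ-*ˡ n c (λ v → f (a ∷ v)))
    (sym (*-distribˡ-sum c (λ a → sumᵥ n λ v → f (a ∷ v))))

  sumᵥ-*ʳ : ∀ n c f → sumᵥ n (λ v → f v * c) ≡ sumᵥ n f * c
  sumᵥ-*ʳ n c f = trans (sumᵥ-cong n λ v → ℤ.*-comm (f v) c) (trans (sumᵥ-*ˡ n c f) (ℤ.*-comm c (sumᵥ n f)))

  sumᵥ-minus : ∀ n f g → sumᵥ n (λ v → f v - g v) ≡ sumᵥ n f - sumᵥ n g
  sumᵥ-minus n f g = trans (sumᵥ-cong n λ v → eq (f v) (g v)) (trans (sumᵥ-+ n f (λ v → - 1ℤ * g v))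
    (trans (cong (sumᵥ n f +_) (sumᵥ-*ˡ n (- 1ℤ) g)) (sym (eq (sumᵥ n f) (sumᵥ n g)))))
    where
    eq : ∀ a b → a - b ≡ a + - 1ℤ * b
    eq = solve-∀

  length-filter-vectors : ∀ n (X : Vec 𝔽 n → Bool) →
    pos (length (filterᵇ X (vectors n))) ≡ sumᵥ n (λ v → if X v then 1ℤ else 0ℤ)
  length-filter-vectors zero    X with X []
  ... | true  = refl
  ... | false = refl
  length-filter-vectors (suc n) X = by-head p id
    where
    -- `allFin p` is `tabulate id`; replacing `id` by an arbitrary h lets the induction run along
    -- the list of heads.
    by-head : ∀ m (h : Fin m → 𝔽) →
      pos (length (filterᵇ X (cartesianProductWith _∷_ (tabulate h) (vectors n)))) ≡
      sum (λ i → sumᵥ n λ v → if X (h i ∷ v) then 1ℤ else 0ℤ)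
    by-head zero    h = refl
    by-head (suc m) h = begin
      pos (length (filterᵇ X (List.map (h zero ∷_) (vectors n) ++ rest)))
        ≡⟨ cong pos (length-filter-++ X (List.map (h zero ∷_) (vectors n)) rest) ⟩
      pos (length (filterᵇ X (List.map (h zero ∷_) (vectors n))) ℕ.+ length (filterᵇ X rest))
        ≡⟨ pos-+ (length (filterᵇ X (List.map (h zero ∷_) (vectors n)))) (length (filterᵇ X rest)) ⟩
      pos (length (filterᵇ X (List.map (h zero ∷_) (vectors n)))) + pos (length (filterᵇ X rest))
        ≡⟨ cong₂ _+_ (trans (cong pos (length-filter-map X (h zero ∷_) (vectors n)))
                            (length-filter-vectors n (λ v → X (h zero ∷ v))))
                     (by-head m (h ∘ suc)) ⟩
      sum (λ i → sumᵥ n λ v → if X (h i ∷ v) then 1ℤ else 0ℤ) ∎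
      where
      open ≡-Reasoning
      rest = cartesianProductWith _∷_ (tabulate (h ∘ suc)) (vectors n)

  ∣∣ₛ-sum : ∀ X → pos ∣ X ∣ₛ ≡ sumᵥ 3 (𝟙 X)
  ∣∣ₛ-sum X = length-filter-vectors 3 X

  -- Integer coordinates of points

  x₁ x₂ x₃ : Point → ℤ
  x₁ (a ∷ _ ∷ _ ∷ []) = ι a
  x₂ (_ ∷ b ∷ _ ∷ []) = ι b
  x₃ (_ ∷ _ ∷ c ∷ []) = ι c

  point : ℤ → ℤ → ℤ → Point
  point a b c = ρ a ∷ ρ b ∷ ρ c ∷ []

  point-ext : ∀ v w → x₁ v ≋ x₁ w → x₂ v ≋ x₂ w → x₃ v ≋ x₃ w → v ≡ w
  point-ext (_ ∷ _ ∷ _ ∷ []) (_ ∷ _ ∷ _ ∷ []) h₁ h₂ h₃ =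
    cong₂ _∷_ (ι-injective h₁) (cong₂ _∷_ (ι-injective h₂) (cong (_∷ []) (ι-injective h₃)))

  -- The trailing `0𝔽` is the end of the fold in `combination`: the left side is a coordinate of a
  -- point of a line as it reduces.
  ι-affine₁ : ∀ a t u → ι (a +𝔽 (t *𝔽 u +𝔽 0𝔽)) ≋ ι a + ι t * ι u
  ι-affine₁ a t u = ≋-trans (ι-+ a _) (+-cong-≋ (≋-refl {ι a})
    (≋-trans (ι-+ (t *𝔽 u) 0𝔽) (≋-trans (+-cong-≋ (ι-* t u) ι-0) (≋-reflexive (ℤ.+-identityʳ (ι t * ι u))))))

  ι-affine₂ : ∀ a s u t v → ι (a +𝔽 (s *𝔽 u +𝔽 (t *𝔽 v +𝔽 0𝔽))) ≋ ι a + (ι s * ι u + ι t * ι v)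
  ι-affine₂ a s u t v = ≋-trans (ι-+ a _) (+-cong-≋ (≋-refl {ι a})
    (≋-trans (ι-affine₁ (s *𝔽 u) t v) (+-cong-≋ (ι-* s u) (≋-refl {ι t * ι v}))))

  -- Affine lines

  -- A parallel class, whose lines are cut out by form₁ ≡ r and form₂ ≡ s.
  record LineFamily : Set where
    field
      direction   : Point
      independent : LinearlyIndependent (direction ∷ [])
      base        : ℤ → ℤ → Point
      form₁ form₂ : Point → ℤ
      spans       : ∀ r s x → (P ∣ form₁ x - r × P ∣ form₂ x - s) ⇔ (∃[ cs ] x ≡ base r s +ᵥ combination cs (direction ∷ []))
      total       : ∀ r s → sumᵥ 3 (λ x → ε (form₁ x - r) * ε (form₂ x - s)) ≡ P

    indicator : ℤ → ℤ → Point → ℤ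
    indicator r s x = ε (form₁ x - r) * ε (form₂ x - s)

    line : ℤ → ℤ → PointSet
    line r s x = ⌊ P ∣? form₁ x - r ⌋ ∧ ⌊ P ∣? form₂ x - s ⌋

    𝟙-line : ∀ r s x → 𝟙 (line r s) x ≡ indicator r s x
    𝟙-line r s x with P ∣? form₁ x - r | P ∣? form₂ x - s
    ... | yes _ | yes _ = refl
    ... | yes _ | no  _ = refl
    ... | no  _ | yes _ = refl
    ... | no  _ | no  _ = refl

    ∈line : ∀ r s x → x ∈ line r s ⇔ (P ∣ form₁ x - r × P ∣ form₂ x - s)
    ∈line r s x with P ∣? form₁ x - r | P ∣? form₂ x - s
    ... | yes P∣₁ | yes P∣₂ = mk⇔ (λ _ → P∣₁ , P∣₂) (λ _ → refl)
    ... | yes _   | no P∤₂  = mk⇔ (λ ()) (λ h → contradiction (proj₂ h) P∤₂)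
    ... | no P∤₁  | yes _   = mk⇔ (λ ()) (λ h → contradiction (proj₁ h) P∤₁)
    ... | no P∤₁  | no _    = mk⇔ (λ ()) (λ h → contradiction (proj₁ h) P∤₁)

    line-translate : ∀ r s → IsTranslateOfSpan (line r s) (base r s) (direction ∷ [])
    line-translate r s x = mk⇔ (Equivalence.to (spans r s x) ∘ Equivalence.to (∈line r s x))
                               (Equivalence.from (∈line r s x) ∘ Equivalence.from (spans r s x))

    line-isLine : ∀ r s → IsLine (line r s)
    line-isLine r s = base r s , direction ∷ [] , independent , line-translate r s

    line-∥ : ∀ r s r′ s′ → line r s ∥ line r′ s′
    line-∥ r s r′ s′ = direction , independent , (base r s , line-translate r s) , (base r′ s′ , line-translate r′ s′)

  open LineFamily

  -- The line differences taken below vary `form₁` at a fixed value of `form₂`. Exchanging the forms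
  -- keeps the lines and makes the other form the variable one.
  swap : LineFamily → LineFamily
  swap F = record
    { direction   = direction F
    ; independent = independent F
    ; base        = λ r s → base F s r
    ; form₁       = form₂ F
    ; form₂       = form₁ F
    ; spans       = λ r s x → mk⇔ (λ h → Equivalence.to (spans F s r x) (proj₂ h , proj₁ h))
                                  (λ h → let (h₁ , h₂) = Equivalence.from (spans F s r x) h in h₂ , h₁)
    ; total       = λ r s → trans (sumᵥ-cong 3 λ x → ℤ.*-comm (ε (form₂ F x - r)) (ε (form₁ F x - s))) (total F s r)
    }

  -- Gives the independence of a direction vector with a coordinate 1, which each family below has.
  zero-scalar : ∀ c {u} → ι u ≋ 1ℤ → c *𝔽 u +𝔽 0𝔽 ≡ 0𝔽 → c ≡ 0𝔽
  zero-scalar c {u} u≋1 eq = ι-injective (≋-trans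
    (≋-reflexive (sym (trans (ℤ.+-identityʳ _) (ℤ.*-identityʳ (ι c)))))
    (≋-trans (+-cong-≋ (*-cong-≋ (≋-refl {ι c}) (≋-sym u≋1)) (≋-sym ι-0))
      (≋-trans (≋-sym (≋-trans (ι-+ (c *𝔽 u) 0𝔽) (+-cong-≋ (ι-* c u) ≋-refl))) (≋-reflexive (cong ι eq)))))

  coordinate : ∀ r t u → ι (ρ r +𝔽 (t *𝔽 ρ u +𝔽 0𝔽)) ≋ r + ι t * u
  coordinate r t u = ≋-trans (ι-affine₁ (ρ r) t (ρ u)) (+-cong-≋ (ι-ρ r) (*-cong-≋ (≋-refl {ι t}) (ι-ρ u)))

  -- The direction (1, -α, -β) spans the common kernel of the two forms, and x₁ is the parameter
  -- along each line.
  slanted : ℤ → ℤ → LineFamily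
  slanted α β = record
    { direction   = point 1ℤ (- α) (- β)
    ; independent = λ { (c ∷ []) eq → cong (_∷ []) (zero-scalar c (ι-ρ 1ℤ) (cong Vec.head eq)) }
    ; base        = point 0ℤ
    ; form₁       = λ x → x₂ x + α * x₁ x
    ; form₂       = λ x → x₃ x + β * x₁ x
    ; spans       = λ { r s (a ∷ b ∷ c ∷ []) → mk⇔
        (λ { (h₁ , h₂) → (a ∷ []) , point-ext _ _
          (≋-sym (≋-trans (coordinate 0ℤ a 1ℤ) (≋-reflexive (eq₀ (ι a)))))
          (≋-sym (≋-trans (coordinate r a (- α)) (≋-trans (+-cong-≋ (≋-sym (∣-⇒≋ (ι b + α * ι a) r h₁)) (≋-refl {ι a * - α})) (≋-reflexive (eq₁ (ι b) α (ι a))))))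
          (≋-sym (≋-trans (coordinate s a (- β)) (≋-trans (+-cong-≋ (≋-sym (∣-⇒≋ (ι c + β * ι a) s h₂)) (≋-refl {ι a * - β})) (≋-reflexive (eq₁ (ι c) β (ι a)))))) })
        (λ { ((t ∷ []) , refl) →
          let a≋t = ≋-trans (coordinate 0ℤ t 1ℤ) (≋-reflexive (eq₀ (ι t)))
          in ≋⇒∣- (≋-trans (+-cong-≋ (coordinate r t (- α)) (*-cong-≋ (≋-refl {α}) a≋t)) (≋-reflexive (eq₂ r α (ι t))))
           , ≋⇒∣- (≋-trans (+-cong-≋ (coordinate s t (- β)) (*-cong-≋ (≋-refl {β}) a≋t)) (≋-reflexive (eq₂ s β (ι t)))) }) }
    -- Each value of x₁ determines x₂ and x₃, so the p values contribute 1 each.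
    ; total       = λ r s → trans (sum-cong-≗ λ a → trans
        (sum-cong-≗ λ b → trans (sym (*-distribˡ-sum (ε (ι b + α * ι a - r)) (λ c → ε (ι c + β * ι a - s))))
                                (trans (cong (ε (ι b + α * ι a - r) *_) (sum-ε-shift (β * ι a) s)) (ℤ.*-identityʳ _)))
        (sum-ε-shift (α * ι a) r)) (trans (sum-const p 1ℤ) (ℤ.*-identityʳ P))
    }
    where
    eq₀ : ∀ a → 0ℤ + a * 1ℤ ≡ a
    eq₀ = solve-∀
    eq₁ : ∀ b α a → b + α * a + a * - α ≡ b
    eq₁ = solve-∀
    eq₂ : ∀ r α t → r + t * - α + α * t ≡ r
    eq₂ = solve-∀

  -- Has a direction with first coordinate 0, which no `slanted` family has; it completes a pencil
  -- in a plane of constant x₃, as `vertical₃` does for constant x₂.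
  vertical₂ : LineFamily
  vertical₂ = record
    { direction   = point 0ℤ 1ℤ 0ℤ
    ; independent = λ { (c ∷ []) eq → cong (_∷ []) (zero-scalar c (ι-ρ 1ℤ) (cong (Vec.head ∘ Vec.tail) eq)) }
    ; base        = λ r s → point r 0ℤ s
    ; form₁       = x₁
    ; form₂       = x₃
    ; spans       = λ { r s (a ∷ b ∷ c ∷ []) → mk⇔
        (λ { (h₁ , h₂) → (b ∷ []) , point-ext _ _
          (≋-trans (∣-⇒≋ (ι a) r h₁) (≋-sym (≋-trans (coordinate r b 0ℤ) (≋-reflexive (eq₁ r (ι b))))))
          (≋-sym (≋-trans (coordinate 0ℤ b 1ℤ) (≋-reflexive (eq₀ (ι b)))))
          (≋-trans (∣-⇒≋ (ι c) s h₂) (≋-sym (≋-trans (coordinate s b 0ℤ) (≋-reflexive (eq₁ s (ι b)))))) })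
        (λ { ((t ∷ []) , refl) →
             ≋⇒∣- (≋-trans (coordinate r t 0ℤ) (≋-reflexive (eq₁ r (ι t))))
           , ≋⇒∣- (≋-trans (coordinate s t 0ℤ) (≋-reflexive (eq₁ s (ι t)))) }) }
    ; total       = λ r s → trans
        (sum-cong-≗ λ a → trans
          (sum-cong-≗ {n = p} λ b → trans (sym (*-distribˡ-sum (ε (ι a - r)) (λ c → ε (ι c - s))))
            (trans (cong (ε (ι a - r) *_) (sum-ε-at s)) (ℤ.*-identityʳ (ε (ι a - r)))))
          (sum-const p (ε (ι a - r))))
        (trans (sym (*-distribˡ-sum P (λ a → ε (ι a - r)))) (trans (cong (P *_) (sum-ε-at r)) (ℤ.*-identityʳ P)))
    }
    where
    eq₀ : ∀ a → 0ℤ + a * 1ℤ ≡ a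
    eq₀ = solve-∀
    eq₁ : ∀ r a → r + a * 0ℤ ≡ r
    eq₁ = solve-∀

  vertical₃ : LineFamily
  vertical₃ = record
    { direction   = point 0ℤ 0ℤ 1ℤ
    ; independent = λ { (c ∷ []) eq → cong (_∷ []) (zero-scalar c (ι-ρ 1ℤ) (cong (Vec.head ∘ Vec.tail ∘ Vec.tail) eq)) }
    ; base        = λ r s → point r s 0ℤ
    ; form₁       = x₁
    ; form₂       = x₂
    ; spans       = λ { r s (a ∷ b ∷ c ∷ []) → mk⇔
        (λ { (h₁ , h₂) → (c ∷ []) , point-ext _ _
          (≋-trans (∣-⇒≋ (ι a) r h₁) (≋-sym (≋-trans (coordinate r c 0ℤ) (≋-reflexive (eq₁ r (ι c))))))
          (≋-trans (∣-⇒≋ (ι b) s h₂) (≋-sym (≋-trans (coordinate s c 0ℤ) (≋-reflexive (eq₁ s (ι c))))))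
          (≋-sym (≋-trans (coordinate 0ℤ c 1ℤ) (≋-reflexive (eq₀ (ι c))))) })
        (λ { ((t ∷ []) , refl) →
             ≋⇒∣- (≋-trans (coordinate r t 0ℤ) (≋-reflexive (eq₁ r (ι t))))
           , ≋⇒∣- (≋-trans (coordinate s t 0ℤ) (≋-reflexive (eq₁ s (ι t)))) }) }
    ; total       = λ r s → trans
        (sum-cong-≗ λ a → trans
          (sum-cong-≗ λ b → sum-const p (ε (ι a - r) * ε (ι b - s)))
          (trans (sum-cong-≗ λ b → sym (ℤ.*-assoc P (ε (ι a - r)) (ε (ι b - s))))
            (trans (sym (*-distribˡ-sum (P * ε (ι a - r)) (λ b → ε (ι b - s))))
              (trans (cong (P * ε (ι a - r) *_) (sum-ε-at s)) (ℤ.*-identityʳ (P * ε (ι a - r)))))))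
        (trans (sym (*-distribˡ-sum P (λ a → ε (ι a - r)))) (trans (cong (P *_) (sum-ε-at r)) (ℤ.*-identityʳ P)))
    }
    where
    eq₀ : ∀ a → 0ℤ + a * 1ℤ ≡ a
    eq₀ = solve-∀
    eq₁ : ∀ r a → r + a * 0ℤ ≡ r
    eq₁ = solve-∀

  ⌊⌋-true : ∀ {A : Set} (A? : Dec A) → ⌊ A? ⌋ ≡ true ⇔ A
  ⌊⌋-true (yes a) = mk⇔ (λ _ → a) (λ _ → refl)
  ⌊⌋-true (no ¬a) = mk⇔ (λ ()) (λ a → contradiction a ¬a)

  plane : ℤ → ℤ → ℤ → PointSet
  plane α β r x = ⌊ P ∣? x₁ x + α * x₂ x + β * x₃ x - r ⌋

  -- Solve the equation for x₁ and use x₂ and x₃ as parameters.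
  plane-isPlane : ∀ α β r → IsPlane (plane α β r)
  plane-isPlane α β r = point r 0ℤ 0ℤ , point (- α) 1ℤ 0ℤ ∷ point (- β) 0ℤ 1ℤ ∷ [] ,
    (λ { (s ∷ t ∷ []) eq → cong₂ (λ s t → s ∷ t ∷ [])
      (ι-injective (≋-trans (≋-sym (≋-trans (linear s 1ℤ t 0ℤ) (≋-reflexive (eq₁ (ι s) (ι t))))) (≋-reflexive (cong (ι ∘ Vec.head ∘ Vec.tail) eq))))
      (ι-injective (≋-trans (≋-sym (≋-trans (linear s 0ℤ t 1ℤ) (≋-reflexive (eq₂ (ι s) (ι t))))) (≋-reflexive (cong (ι ∘ Vec.head ∘ Vec.tail ∘ Vec.tail) eq)))) }) ,
    λ { x@(a ∷ b ∷ c ∷ []) → mk⇔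
      (λ x∈ → b ∷ c ∷ [] , point-ext _ _
        (≋-sym (≋-trans (affine r b (- α) c (- β))
          (≋-trans (+-cong-≋ (≋-sym (∣-⇒≋ (ι a + α * ι b + β * ι c) r (Equivalence.to (⌊⌋-true (P ∣? ι a + α * ι b + β * ι c - r)) x∈))) (≋-refl {ι b * - α + ι c * - β}))
            (≋-reflexive (eq₃ (ι a) α (ι b) β (ι c))))))
        (≋-sym (≋-trans (affine 0ℤ b 1ℤ c 0ℤ) (≋-reflexive (trans (ℤ.+-identityˡ _) (eq₁ (ι b) (ι c))))))
        (≋-sym (≋-trans (affine 0ℤ b 0ℤ c 1ℤ) (≋-reflexive (trans (ℤ.+-identityˡ _) (eq₂ (ι b) (ι c)))))))
      (λ { ((s ∷ t ∷ []) , refl) → Equivalence.from (⌊⌋-true (P ∣? _)) (≋⇒∣-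
        (≋-trans (+-cong-≋ (+-cong-≋ (affine r s (- α) t (- β)) (*-cong-≋ (≋-refl {α}) (affine 0ℤ s 1ℤ t 0ℤ))) (*-cong-≋ (≋-refl {β}) (affine 0ℤ s 0ℤ t 1ℤ)))
          (≋-reflexive (eq₄ r α (ι s) β (ι t))))) }) }
    where
    affine : ∀ r s u t v → ι (ρ r +𝔽 (s *𝔽 ρ u +𝔽 (t *𝔽 ρ v +𝔽 0𝔽))) ≋ r + (ι s * u + ι t * v)
    affine r s u t v = ≋-trans (ι-affine₂ (ρ r) s (ρ u) t (ρ v))
      (+-cong-≋ (ι-ρ r) (+-cong-≋ (*-cong-≋ (≋-refl {ι s}) (ι-ρ u)) (*-cong-≋ (≋-refl {ι t}) (ι-ρ v))))
    linear : ∀ s u t v → ι (s *𝔽 ρ u +𝔽 (t *𝔽 ρ v +𝔽 0𝔽)) ≋ ι s * u + ι t * v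
    linear s u t v = ≋-trans (ι-affine₁ (s *𝔽 ρ u) t (ρ v))
      (+-cong-≋ (≋-trans (ι-* s (ρ u)) (*-cong-≋ (≋-refl {ι s}) (ι-ρ u))) (*-cong-≋ (≋-refl {ι t}) (ι-ρ v)))
    eq₁ : ∀ s t → s * 1ℤ + t * 0ℤ ≡ s
    eq₁ = solve-∀
    eq₂ : ∀ s t → s * 0ℤ + t * 1ℤ ≡ t
    eq₂ = solve-∀
    eq₃ : ∀ a α b β c → a + α * b + β * c + (b * - α + c * - β) ≡ a
    eq₃ = solve-∀
    eq₄ : ∀ r α s β t → r + (s * - α + t * - β) + α * (0ℤ + (s * 1ℤ + t * 0ℤ)) + β * (0ℤ + (s * 0ℤ + t * 1ℤ)) ≡ r
    eq₄ = solve-∀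

  -- Cylinders as graphs over a parallel class

  module _ (F : LineFamily) where

    -- The union of the lines form₁ ≡ h i, form₂ ≡ i.
    graph : (𝔽 → ℤ) → PointSet
    graph h x = ⌊ P ∣? form₁ F x - h (ρ (form₂ F x)) ⌋

    -- The lines lie at different values of `form₂`, hence are disjoint for every h, and a point of
    -- the union finds its line from its own value of `form₂`.
    graph-isCylinder : ∀ h → IsCylinder (graph h)
    graph-isCylinder h = (λ i → line F (h i) (ι i)) , (λ i → line-isLine F (h i) (ι i)) , (λ i j → line-∥ F (h i) (ι i) (h j) (ι j)) ,
      (λ i j i≢j x (x∈i , x∈j) → i≢j (ι-injective (≋-trans (≋-sym (second i x∈i)) (second j x∈j)))) ,
      λ x → mk⇔
        (λ x∈ → ρ (form₂ F x) , Equivalence.from (∈line F _ _ x)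
          (Equivalence.to (⌊⌋-true (P ∣? _)) x∈ , ≋⇒∣- (≋-sym (ι-ρ (form₂ F x)))))
        (λ (i , x∈i) → Equivalence.from (⌊⌋-true (P ∣? _))
          (subst (λ j → P ∣ form₁ F x - h j) (trans (sym (ρ-ι i)) (sym (ρ-cong (second i x∈i)))) (proj₁ (Equivalence.to (∈line F _ _ x) x∈i))))
      where
      second : ∀ i {x} → x ∈ line F (h i) (ι i) → form₂ F x ≋ ι i
      second i {x} x∈i = ∣-⇒≋ (form₂ F x) (ι i) (proj₂ (Equivalence.to (∈line F (h i) (ι i) x) x∈i))

    deform : ℤ → ℤ → ℤ → 𝔽 → ℤ
    deform r r′ s i = if ⌊ i Fin.≟ ρ s ⌋ then r′ else r

    -- The two cylinders share all lines except the one at form₂ ≡ s.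
    graph-difference : ∀ r r′ s x →
      indicator F r s x - indicator F r′ s x ≡ 𝟙 (graph (λ _ → r)) x - 𝟙 (graph (deform r r′ s)) x
    graph-difference r r′ s x with ρ (form₂ F x) Fin.≟ ρ s
    ... | yes eq = cong₂ _-_ (on r) (on r′)
      where
      f₂≋s : form₂ F x ≋ s
      f₂≋s = ≋-trans (≋-sym (ι-ρ _)) (≋-trans (≋-reflexive (cong ι eq)) (ι-ρ s))
      on : ∀ r → indicator F r s x ≡ ε (form₁ F x - r)
      on r = trans (cong (ε (form₁ F x - r) *_) (ε-yes (≋⇒∣- f₂≋s))) (ℤ.*-identityʳ _)
    ... | no neq = trans (cong₂ _-_ (off r) (off r′)) (sym (ℤ.+-inverseʳ (ε (form₁ F x - r))))
      where
      off : ∀ r → indicator F r s x ≡ 0ℤ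
      off r = trans (cong (ε (form₁ F x - r) *_) (ε-no λ P∣ → neq (ρ-cong (∣-⇒≋ (form₂ F x) s P∣)))) (ℤ.*-zeroʳ (ε (form₁ F x - r)))

  -- Integer combinations of line differences

  data DifferenceSpan : (Point → ℤ) → Set where
    pointwise   : ∀ {f g} → f ≗ g → DifferenceSpan f → DifferenceSpan g
    nil       : DifferenceSpan (λ _ → 0ℤ)
    plus        : ∀ {f g} → DifferenceSpan f → DifferenceSpan g → DifferenceSpan (λ x → f x + g x)
    times      : ∀ c {f} → DifferenceSpan f → DifferenceSpan (λ x → c * f x)
    difference : ∀ F r r′ s → DifferenceSpan (λ x → indicator F r s x - indicator F r′ s x)

  -- All lines have p points. This invariant later forces total 0 on the function m in the error
  -- term p m.
  total-zero : ∀ {f} → DifferenceSpan f → sumᵥ 3 f ≡ 0ℤ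
  total-zero (pointwise f≗g Df)     = trans (sym (sumᵥ-cong 3 f≗g)) (total-zero Df)
  total-zero nil                  = trans (sumᵥ-*ˡ 3 0ℤ (λ _ → 0ℤ)) (ℤ.*-zeroˡ (sumᵥ 3 (λ _ → 0ℤ)))
  total-zero (plus {f} {g} Df Dg)   = trans (sumᵥ-+ 3 f g) (cong₂ _+_ (total-zero Df) (total-zero Dg))
  total-zero (times c {f} Df)      = trans (sumᵥ-*ˡ 3 c f) (trans (cong (c *_) (total-zero Df)) (ℤ.*-zeroʳ c))
  total-zero (difference F r r′ s) = trans (sumᵥ-minus 3 (indicator F r s) (indicator F r′ s))
    (trans (cong₂ _-_ (total F r s) (total F r′ s)) (ℤ.+-inverseʳ P))

  module IntegerSpan (G : (Point → ℤ) → Set) where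

    Span-resp : ∀ {f g} → f ≗ g → Spanℤ G f → Spanℤ G g
    Span-resp f≗g (n , c , h , Gh , eq) = n , c , h , Gh , λ x → trans (sym (f≗g x)) (eq x)

    Span-zero : Spanℤ G (λ _ → 0ℤ)
    Span-zero = 0 , (λ ()) , (λ ()) , (λ ()) , λ _ → refl

    Span-cons : ∀ c {g f} → G g → Spanℤ G f → Spanℤ G (λ x → c * g x + f x)
    Span-cons c {g} Gg (n , cs , gs , Gs , eq) = suc n ,
      (λ { zero → c ; (suc i) → cs i }) , (λ { zero → g ; (suc i) → gs i }) , (λ { zero → Gg ; (suc i) → Gs i }) ,
      λ x → cong (λ z → c * g x + z) (eq x)

    Span-prepend : ∀ n (c : Fin n → ℤ) (h : Fin n → Point → ℤ) → (∀ i → G (h i)) →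
      ∀ {g} → Spanℤ G g → Spanℤ G (λ x → sum {n} (λ i → c i * h i x) + g x)
    Span-prepend zero    c h Gh {g} Sg = Span-resp {f = g} (λ x → sym (ℤ.+-identityˡ (g x))) Sg
    Span-prepend (suc n) c h Gh {g} Sg = Span-resp {f = λ x → c zero * h zero x + (rest x + g x)}
      (λ x → sym (ℤ.+-assoc (c zero * h zero x) (rest x) (g x)))
      (Span-cons (c zero) {h zero} {λ x → rest x + g x} (Gh zero) (Span-prepend n (c ∘ suc) (h ∘ suc) (Gh ∘ suc) Sg))
      where
      rest : Point → ℤ
      rest x = sum {n} (λ i → c (suc i) * h (suc i) x)

    Span-add : ∀ {f g} → Spanℤ G f → Spanℤ G g → Spanℤ G (λ x → f x + g x)
    Span-add {f} {g} (n , c , h , Gh , eq) Sg = Span-resp {f = λ x → sum {n} (λ i → c i * h i x) + g x}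
      (λ x → cong (_+ g x) {sum {n} (λ i → c i * h i x)} {f x} (sym (eq x))) (Span-prepend n c h Gh {g} Sg)

    Span-scale : ∀ c {f} → Spanℤ G f → Spanℤ G (λ x → c * f x)
    Span-scale c (n , cs , g , Gg , eq) = n , (λ i → c * cs i) , g , Gg , λ x →
      trans (cong (c *_) (eq x)) (trans (*-distribˡ-sum c (λ i → cs i * g i x)) (sum-cong-≗ λ i → sym (ℤ.*-assoc c (cs i) (g i x))))

    Span-generator : ∀ {g} → G g → Spanℤ G g
    Span-generator {g} Gg = Span-resp (λ x → trans (ℤ.+-identityʳ (1ℤ * g x)) (ℤ.*-identityˡ (g x))) (Span-cons 1ℤ Gg Span-zero)

    -- One recursion over the closure `DifferenceSpan` serves both conclusions: parallel lines and
    -- cylinders differ only in how a single line difference is expressed.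
    from-differences : (∀ F r r′ s → Spanℤ G (λ x → indicator F r s x - indicator F r′ s x)) →
      ∀ {f} → DifferenceSpan f → Spanℤ G f
    from-differences gen (pointwise f≗g Df)     = Span-resp f≗g (from-differences gen Df)
    from-differences gen nil                  = Span-zero
    from-differences gen (plus Df Dg)           = Span-add (from-differences gen Df) (from-differences gen Dg)
    from-differences gen (times c Df)          = Span-scale c (from-differences gen Df)
    from-differences gen (difference F r r′ s) = gen F r r′ s

  to-parallel-lines : ∀ {f} → DifferenceSpan f → Spanℤ ParallelLineDifference f
  to-parallel-lines = from-differences λ F r r′ s → Span-generator
    (line F r s , line F r′ s , line-isLine F r s , line-isLine F r′ s , line-∥ F r s r′ s ,
      λ x → sym (cong₂ _-_ (𝟙-line F r s x) (𝟙-line F r′ s x)))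
    where open IntegerSpan ParallelLineDifference

  graph-indicator : ∀ F h → CylinderIndicator (𝟙 (graph F h))
  graph-indicator F h = graph F h , graph-isCylinder F h , λ _ → refl

  to-cylinders : ∀ {f} → DifferenceSpan f → Spanℤ CylinderIndicator f
  to-cylinders = from-differences λ F r r′ s →
    let C = graph F (λ _ → r); C′ = graph F (deform F r r′ s) in
    Span-resp {f = λ x → 1ℤ * 𝟙 C x + - 1ℤ * 𝟙 C′ x} (λ x → trans (eq (𝟙 C x) (𝟙 C′ x)) (sym (graph-difference F r r′ s x)))
      (Span-cons 1ℤ (graph-indicator F (λ _ → r)) (Span-scale (- 1ℤ) (Span-generator (graph-indicator F (deform F r r′ s)))))
    where
    open IntegerSpan CylinderIndicator
    eq : ∀ a b → 1ℤ * a + - 1ℤ * b ≡ a - b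
    eq = solve-∀

  span-sum : ∀ {n} {g : Fin n → Point → ℤ} → (∀ i → DifferenceSpan (g i)) → DifferenceSpan (λ x → sum (λ i → g i x))
  span-sum {zero}  Dg = nil
  span-sum {suc n} Dg = plus (Dg zero) (span-sum (Dg ∘ suc))

  span-sumᵥ : ∀ n {g : Vec 𝔽 n → Point → ℤ} → (∀ v → DifferenceSpan (g v)) → DifferenceSpan (λ x → sumᵥ n (λ v → g v x))
  span-sumᵥ zero    Dg = Dg []
  span-sumᵥ (suc n) Dg = span-sum λ a → span-sumᵥ n λ v → Dg (a ∷ v)

  -- For b ≢ 0 exactly one slope c satisfies a + c b ≡ 0.
  pencil : ∀ a b → sum (λ c → ε (a + ι c * b)) + ε b ≡ 1ℤ + P * (ε a * ε b)
  pencil a b with P ∣? b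
  -- For b ≡ 0 the summand does not depend on c, so all p slopes count or none does.
  ... | yes P∣b = trans (cong₂ _+_ (trans (sum-cong-≗ λ c → ε-cong (vanish c)) (sum-const p (ε a))) (refl {x = 1ℤ}))
                        (eq P (ε a))
    where
    vanish : ∀ c → a + ι c * b ≋ a
    vanish c = ≋-trans (+-cong-≋ (≋-refl {a}) (*-cong-≋ (≋-refl {ι c}) (∣⇒≋0 P∣b)))
      (≋-reflexive (trans (cong (λ z → a + z) (ℤ.*-zeroʳ (ι c))) (ℤ.+-identityʳ a)))
    eq : ∀ P e → P * e + 1ℤ ≡ 1ℤ + P * (e * 1ℤ)
    eq = solve-∀
  ... | no P∤b with inverse b P∤b
  ...   | d , bd≋1 = trans (cong (_+ 0ℤ) (trans (sum-cong-≗ λ c → ε-iff (solve-for c) (check c)) (sum-ε-1 (- (a * d)))))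
                           (eq P (ε a))
    where
    solve-for : ∀ c → P ∣ a + ι c * b → P ∣ - (a * d) - ι c
    solve-for c P∣ = ≋0⇒∣ (≋-trans (+-cong-≋ (≋-refl { - (a * d)}) (neg-cong-≋ (≋-trans (≋-reflexive (sym (ℤ.*-identityʳ (ι c)))) (*-cong-≋ (≋-refl {ι c}) (≋-sym bd≋1)))))
      (≋-trans (≋-reflexive (eq₁ a b d (ι c))) (∣⇒≋0 (ℤ∣.∣n⇒∣m*n (- d) P∣))))
      where
      eq₁ : ∀ a b d c → - (a * d) - c * (b * d) ≡ - d * (a + c * b)
      eq₁ = solve-∀
    check : ∀ c → P ∣ - (a * d) - ι c → P ∣ a + ι c * b
    check c P∣ = ≋0⇒∣ (≋-trans (+-cong-≋ (≋-trans (≋-reflexive (sym (ℤ.*-identityʳ a))) (*-cong-≋ (≋-refl {a}) (≋-sym bd≋1))) (≋-refl {ι c * b}))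
      (≋-trans (≋-reflexive (eq₁ a b d (ι c))) (∣⇒≋0 (ℤ∣.∣n⇒∣m*n (- b) P∣))))
      where
      eq₁ : ∀ a b d c → a * (b * d) + c * b ≡ - b * (- (a * d) - c)
      eq₁ = solve-∀
    eq : ∀ P e → 1ℤ + 0ℤ ≡ 1ℤ + P * (e * 0ℤ)
    eq = solve-∀

  -- Pencils of lines and multiples of p

  module _ (F : ℤ → LineFamily) (G : LineFamily) {A B S : Point → ℤ}
    (F₁ : ∀ c x → form₁ (F c) x ≡ A x + c * B x) (F₂ : ∀ c x → form₂ (F c) x ≡ S x)
    (G₁ : ∀ x → form₁ G x ≡ B x) (G₂ : ∀ x → form₂ G x ≡ S x) where

    through : ℤ → ℤ → ℤ → 𝔽 → Point → ℤ
    through s a b c = indicator (F (ι c)) (a + ι c * b) s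

    -- The p + 1 lines through (a, b) in the plane S = s cover it once, except that they cover (a, b) p + 1 times.
    pencil-sum : ℤ → ℤ → ℤ → Point → ℤ
    pencil-sum s a b x = sum (λ c → through s a b c x) + indicator G b s x

    pencil-sum-value : ∀ s a b x → pencil-sum s a b x ≡ (1ℤ + P * (ε (A x - a) * ε (B x - b))) * ε (S x - s)
    pencil-sum-value s a b x = begin
      pencil-sum s a b x
        ≡⟨ cong₂ _+_ (sum-cong-≗ λ c → cong₂ (λ y z → ε y * ε (z - s)) (trans (cong (_- (a + ι c * b)) (F₁ (ι c) x)) (eq (A x) (ι c) (B x) a b)) (F₂ (ι c) x))
                     (cong₂ (λ y z → ε (y - b) * ε (z - s)) (G₁ x) (G₂ x)) ⟩
      sum (λ c → ε (A x - a + ι c * (B x - b)) * ε (S x - s)) + ε (B x - b) * ε (S x - s)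
        ≡⟨ cong (_+ ε (B x - b) * ε (S x - s)) (sym (*-distribʳ-sum (ε (S x - s)) (λ c → ε (A x - a + ι c * (B x - b))))) ⟩
      sum (λ c → ε (A x - a + ι c * (B x - b))) * ε (S x - s) + ε (B x - b) * ε (S x - s)
        ≡⟨ sym (ℤ.*-distribʳ-+ (ε (S x - s)) (sum (λ c → ε (A x - a + ι c * (B x - b)))) (ε (B x - b))) ⟩
      (sum (λ c → ε (A x - a + ι c * (B x - b))) + ε (B x - b)) * ε (S x - s)
        ≡⟨ cong (_* ε (S x - s)) (pencil (A x - a) (B x - b)) ⟩
      (1ℤ + P * (ε (A x - a) * ε (B x - b))) * ε (S x - s) ∎
      where
      open ≡-Reasoning
      eq : ∀ A c B a b → A + c * B - (a + c * b) ≡ A - a + c * (B - b)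
      eq = solve-∀

    -- Here A and B are coordinates on the plane S = s. Subtract two pencils, pairing lines of equal
    -- slope: the single covers of the plane cancel, and p times the difference of the two centres
    -- remains.
    move-in-plane : ∀ s a b a′ b′ → DifferenceSpan (λ x →
      P * (ε (A x - a) * ε (B x - b) * ε (S x - s)) - P * (ε (A x - a′) * ε (B x - b′) * ε (S x - s)))
    move-in-plane s a b a′ b′ = pointwise (λ x → begin
        sum (λ c → through s a b c x - through s a′ b′ c x) + (indicator G b s x - indicator G b′ s x)
          ≡⟨ cong (_+ (indicator G b s x - indicator G b′ s x)) (sum-minus (λ c → through s a b c x) (λ c → through s a′ b′ c x)) ⟩
        sum (λ c → through s a b c x) - sum (λ c → through s a′ b′ c x) + (indicator G b s x - indicator G b′ s x)
          ≡⟨ eq₁ (sum (λ c → through s a b c x)) (sum (λ c → through s a′ b′ c x)) (indicator G b s x) (indicator G b′ s x) ⟩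
        pencil-sum s a b x - pencil-sum s a′ b′ x
          ≡⟨ cong₂ _-_ (pencil-sum-value s a b x) (pencil-sum-value s a′ b′ x) ⟩
        (1ℤ + P * (ε (A x - a) * ε (B x - b))) * ε (S x - s) - (1ℤ + P * (ε (A x - a′) * ε (B x - b′))) * ε (S x - s)
          ≡⟨ eq₂ P (ε (A x - a) * ε (B x - b)) (ε (A x - a′) * ε (B x - b′)) (ε (S x - s)) ⟩
        P * (ε (A x - a) * ε (B x - b) * ε (S x - s)) - P * (ε (A x - a′) * ε (B x - b′) * ε (S x - s)) ∎)
      (plus (span-sum λ c → difference (F (ι c)) (a + ι c * b) (a′ + ι c * b′) s) (difference G b b′ s))
      where
      open ≡-Reasoning
      eq₁ : ∀ a b c d → (a - b) + (c - d) ≡ (a + c) - (b + d)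
      eq₁ = solve-∀
      eq₂ : ∀ P u v w → (1ℤ + P * u) * w - (1ℤ + P * v) * w ≡ P * (u * w) - P * (v * w)
      eq₂ = solve-∀

  δ : ℤ → ℤ → ℤ → Point → ℤ
  δ a b c x = ε (x₁ x - a) * ε (x₂ x - b) * ε (x₃ x - c)

  -- Go from (a, b, c) to (0, 0, c) inside the plane x₃ = c, then to the origin inside x₂ = 0.
  move-point : ∀ a b c → DifferenceSpan (λ x → P * δ a b c x - P * δ 0ℤ 0ℤ 0ℤ x)
  move-point a b c = pointwise (λ x → eq (ε (x₁ x - a)) (ε (x₂ x - b)) (ε (x₃ x - c)) (ε (x₁ x - 0ℤ)) (ε (x₂ x - 0ℤ)) (ε (x₃ x - 0ℤ)) P)
    (plus
      (move-in-plane (λ d → slanted d 0ℤ) vertical₂ {x₂} {x₁} {x₃}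
        (λ _ _ → refl) (λ _ x → drop-zero (x₃ x) (x₁ x)) (λ _ → refl) (λ _ → refl) c b a 0ℤ 0ℤ)
      (move-in-plane (λ d → swap (slanted 0ℤ d)) vertical₃ {x₃} {x₁} {x₂}
        (λ _ _ → refl) (λ _ x → drop-zero (x₂ x) (x₁ x)) (λ _ → refl) (λ _ → refl) 0ℤ c 0ℤ 0ℤ 0ℤ))
    where
    drop-zero : ∀ a b → a + 0ℤ * b ≡ a
    drop-zero = solve-∀
    eq : ∀ a b c o₁ o₂ o₃ P → (P * (b * a * c) - P * (o₂ * o₁ * c)) + (P * (c * o₁ * o₂) - P * (o₃ * o₁ * o₂)) ≡
      P * (a * b * c) - P * (o₁ * o₂ * o₃)
    eq = solve-∀

  sum-δ : ∀ (m : Point → ℤ) x → sumᵥ 3 (λ v → m v * δ (x₁ v) (x₂ v) (x₃ v) x) ≡ m x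
  sum-δ m (a ∷ b ∷ c ∷ []) = begin
    sum (λ r → sum λ s → sum λ t → m (r ∷ s ∷ t ∷ []) * (ε (ι a - ι r) * ε (ι b - ι s) * ε (ι c - ι t)))
      ≡⟨ (sum-cong-≗ λ r → sum-cong-≗ λ s → trans (sum-cong-≗ λ t → sym (ℤ.*-assoc (m (r ∷ s ∷ t ∷ [])) (ε (ι a - ι r) * ε (ι b - ι s)) (ε (ι c - ι t))))
          (trans (sum-ε (ι c) (λ t → m (r ∷ s ∷ t ∷ []) * (ε (ι a - ι r) * ε (ι b - ι s)))) (cong (λ t → m (r ∷ s ∷ t ∷ []) * (ε (ι a - ι r) * ε (ι b - ι s))) (ρ-ι c)))) ⟩
    sum (λ r → sum λ s → m (r ∷ s ∷ c ∷ []) * (ε (ι a - ι r) * ε (ι b - ι s)))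
      ≡⟨ (sum-cong-≗ λ r → trans (sum-cong-≗ λ s → sym (ℤ.*-assoc (m (r ∷ s ∷ c ∷ [])) (ε (ι a - ι r)) (ε (ι b - ι s))))
          (trans (sum-ε (ι b) (λ s → m (r ∷ s ∷ c ∷ []) * ε (ι a - ι r))) (cong (λ s → m (r ∷ s ∷ c ∷ []) * ε (ι a - ι r)) (ρ-ι b)))) ⟩
    sum (λ r → m (r ∷ b ∷ c ∷ []) * ε (ι a - ι r))
      ≡⟨ trans (sum-ε (ι a) (λ r → m (r ∷ b ∷ c ∷ []))) (cong (λ r → m (r ∷ b ∷ c ∷ [])) (ρ-ι a)) ⟩
    m (a ∷ b ∷ c ∷ []) ∎
    where open ≡-Reasoning

  -- Move the mass m(v) from the origin to v for every v. The total mass taken from the origin is 0,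
  -- so only p m is left.
  p-multiple : ∀ m → sumᵥ 3 m ≡ 0ℤ → DifferenceSpan (λ x → P * m x)
  p-multiple m Σm≡0 = pointwise (λ x → begin
      sumᵥ 3 (λ v → m v * (P * δ (x₁ v) (x₂ v) (x₃ v) x - P * δ 0ℤ 0ℤ 0ℤ x))
        ≡⟨ sumᵥ-cong 3 (λ v → eq₁ (m v) P (δ (x₁ v) (x₂ v) (x₃ v) x) (δ 0ℤ 0ℤ 0ℤ x)) ⟩
      sumᵥ 3 (λ v → P * (m v * δ (x₁ v) (x₂ v) (x₃ v) x) - m v * (P * δ 0ℤ 0ℤ 0ℤ x))
        ≡⟨ sumᵥ-minus 3 (λ v → P * (m v * δ (x₁ v) (x₂ v) (x₃ v) x)) (λ v → m v * (P * δ 0ℤ 0ℤ 0ℤ x)) ⟩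
      sumᵥ 3 (λ v → P * (m v * δ (x₁ v) (x₂ v) (x₃ v) x)) - sumᵥ 3 (λ v → m v * (P * δ 0ℤ 0ℤ 0ℤ x))
        ≡⟨ cong₂ _-_ (trans (sumᵥ-*ˡ 3 P (λ v → m v * δ (x₁ v) (x₂ v) (x₃ v) x)) (cong (λ z → P * z) {sumᵥ 3 (λ v → m v * δ (x₁ v) (x₂ v) (x₃ v) x)} {m x} (sum-δ m x)))
                     (trans (sumᵥ-*ʳ 3 (P * δ 0ℤ 0ℤ 0ℤ x) m) (trans (cong (λ z → z * (P * δ 0ℤ 0ℤ 0ℤ x)) Σm≡0) (ℤ.*-zeroˡ (P * δ 0ℤ 0ℤ 0ℤ x)))) ⟩
      P * m x - 0ℤ
        ≡⟨ ℤ.+-identityʳ (P * m x) ⟩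
      P * m x ∎)
    (span-sumᵥ 3 λ v → times (m v) (move-point (x₁ v) (x₂ v) (x₃ v)))
    where
    open ≡-Reasoning
    eq₁ : ∀ m P d o → m * (P * d - P * o) ≡ P * (m * d) - m * (P * o)
    eq₁ = solve-∀

  -- Line differences modulo p

  -- The error m is kept explicitly, since its total must be computed when the congruence is lifted
  -- to the integers.
  SpanMod : (Point → ℤ) → Set
  SpanMod f = Σ (Point → ℤ) λ m → DifferenceSpan (λ x → f x - P * m x)

  spanMod : IsSubmodule SpanMod
  spanMod = record
    { respects = λ { f≗g (m , D) → m , pointwise (λ x → cong (_- P * m x) (f≗g x)) D }
    ; add      = λ { {f} {g} (m , D) (m′ , D′) → (λ x → m x + m′ x) ,
        pointwise (λ x → eq₁ (f x) (g x) P (m x) (m′ x)) (plus D D′) }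
    ; scale    = λ { c {f} (m , D) → (λ x → c * m x) , pointwise (λ x → eq₂ c (f x) P (m x)) (times c D) }
    ; multiple = λ f → f , pointwise (λ x → sym (ℤ.+-inverseʳ (P * f x))) nil
    }
    where
    eq₁ : ∀ f g P m n → f - P * m + (g - P * n) ≡ f + g - P * (m + n)
    eq₁ = solve-∀
    eq₂ : ∀ c f P m → c * (f - P * m) ≡ c * f - P * (c * m)
    eq₂ = solve-∀

  module _ {X : Set} {K : (X → ℤ) → Set} (K-isSubmodule : IsSubmodule K) where
    open IsSubmodule K-isSubmodule

    -- Sort the points by the residue r of l: modulo p, the power l^n is the sum of the r^n times
    -- the indicators of l ≡ r.
    power-from-indicators : ∀ n {l e : X → ℤ} → (∀ r → K (λ x → ε (l x - ι r) * e x)) → K (λ x → l x ^ᶻ n * e x)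
    power-from-indicators n {l} {e} Kε = resp-≋
      {λ x → sum (λ r → ι r ^ᶻ n * (ε (l x - ι r) * e x))} {λ x → l x ^ᶻ n * e x}
      (λ x → ≋-trans (≋-reflexive (value x)) (*-cong-≋ (^-cong-≋ n (ι-ρ (l x))) (≋-refl {e x})))
      (sum-closed λ r → scale (ι r ^ᶻ n) {λ x → ε (l x - ι r) * e x} (Kε r))
      where
      value : ∀ x → sum (λ r → ι r ^ᶻ n * (ε (l x - ι r) * e x)) ≡ ι (ρ (l x)) ^ᶻ n * e x
      value x = trans (sum-cong-≗ λ r → sym (ℤ.*-assoc (ι r ^ᶻ n) (ε (l x - ι r)) (e x)))
        (trans (sym (*-distribʳ-sum (e x) (λ r → ι r ^ᶻ n * ε (l x - ι r))))
          (cong (_* e x) (sum-ε (l x) (λ r → ι r ^ᶻ n))))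

    -- The coefficients r^n sum to 0 modulo p, so it suffices to know differences of indicators.
    power-from-differences : ∀ n → suc n < p → ∀ {l e : X → ℤ} →
      (∀ r → K (λ x → ε (l x - ι r) * e x - ε (l x - 0ℤ) * e x)) → K (λ x → l x ^ᶻ n * e x)
    power-from-differences n n+1<p {l} {e} Kε = resp-≋
      {λ x → sum (λ r → ι r ^ᶻ n * (ε (l x - ι r) * e x - ε (l x - 0ℤ) * e x))} {λ x → l x ^ᶻ n * e x}
      (λ x → ≋-trans (≋-reflexive (value x)) (≋-trans (+-cong-≋ (≋-refl {ι (ρ (l x)) ^ᶻ n * e x}) (neg-cong-≋ (∣⇒≋0 (ℤ∣.∣m⇒∣m*n (ε (l x - 0ℤ) * e x) (power-sum-divisible n n+1<p)))))
        (≋-trans (≋-reflexive (ℤ.+-identityʳ (ι (ρ (l x)) ^ᶻ n * e x))) (*-cong-≋ (^-cong-≋ n (ι-ρ (l x))) (≋-refl {e x})))))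
      (sum-closed λ r → scale (ι r ^ᶻ n) {λ x → ε (l x - ι r) * e x - ε (l x - 0ℤ) * e x} (Kε r))
      where
      value : ∀ x → sum (λ r → ι r ^ᶻ n * (ε (l x - ι r) * e x - ε (l x - 0ℤ) * e x)) ≡
        ι (ρ (l x)) ^ᶻ n * e x - sum (λ r → ι r ^ᶻ n) * (ε (l x - 0ℤ) * e x)
      value x = begin
        sum (λ r → ι r ^ᶻ n * (ε (l x - ι r) * e x - o))
          ≡⟨ sum-cong-≗ (λ r → eq (ι r ^ᶻ n) (ε (l x - ι r)) (e x) o) ⟩
        sum (λ r → ι r ^ᶻ n * ε (l x - ι r) * e x + ι r ^ᶻ n * - o)
          ≡⟨ ∑-distrib-+ (λ r → ι r ^ᶻ n * ε (l x - ι r) * e x) (λ r → ι r ^ᶻ n * - o) ⟩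
        sum (λ r → ι r ^ᶻ n * ε (l x - ι r) * e x) + sum (λ r → ι r ^ᶻ n * - o)
          ≡⟨ cong₂ _+_ (trans (sym (*-distribʳ-sum (e x) (λ r → ι r ^ᶻ n * ε (l x - ι r)))) (cong (_* e x) (sum-ε (l x) (λ r → ι r ^ᶻ n))))
                       (trans (sym (*-distribʳ-sum (- o) (λ r → ι r ^ᶻ n))) (sym (ℤ.neg-distribʳ-* (sum (λ r → ι r ^ᶻ n)) o))) ⟩
        ι (ρ (l x)) ^ᶻ n * e x - sum (λ r → ι r ^ᶻ n) * o ∎
        where
        open ≡-Reasoning
        o = ε (l x - 0ℤ) * e x
        eq : ∀ a b e o → a * (b * e - o) ≡ a * b * e + a * - o
        eq = solve-∀

  module SpanMod = IsSubmodule spanMod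

  line-difference : ∀ F r r′ s → SpanMod (λ x → indicator F r s x - indicator F r′ s x)
  line-difference F r r′ s = (λ _ → 0ℤ) ,
    pointwise (λ x → eq (indicator F r s x - indicator F r′ s x) P) (difference F r r′ s)
    where
    eq : ∀ d P → d ≡ d - P * 0ℤ
    eq = solve-∀

  -- At each fixed value of `form₂`, line differences yield the power of `form₁`, because m < p - 1.
  -- Weighting these by powers of the value of `form₂` then gives any exponent n.
  form-powers₁ : ∀ F m n → suc m < p → SpanMod (λ x → form₁ F x ^ᶻ m * form₂ F x ^ᶻ n)
  form-powers₁ F m n m+1<p = SpanMod.respects (λ x → ℤ.*-comm (form₂ F x ^ᶻ n) (form₁ F x ^ᶻ m))
    (power-from-indicators spanMod n {form₂ F} {λ x → form₁ F x ^ᶻ m} λ s →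
      SpanMod.respects (λ x → ℤ.*-comm (form₁ F x ^ᶻ m) (ε (form₂ F x - ι s)))
        (power-from-differences spanMod m m+1<p {form₁ F} {λ x → ε (form₂ F x - ι s)} λ r → line-difference F (ι r) 0ℤ (ι s)))

  form-powers : ∀ F m n → suc m < p ⊎ suc n < p → SpanMod (λ x → form₁ F x ^ᶻ m * form₂ F x ^ᶻ n)
  form-powers F m n (inj₁ m+1<p) = form-powers₁ F m n m+1<p
  form-powers F m n (inj₂ n+1<p) = SpanMod.respects (λ x → ℤ.*-comm (form₂ F x ^ᶻ n) (form₁ F x ^ᶻ m)) (form-powers₁ (swap F) n m n+1<p)

  monomial : ℕ → ℕ → ℕ → Point → ℤ
  monomial i j k x = x₁ x ^ᶻ i * (x₂ x ^ᶻ j * x₃ x ^ᶻ k)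

  -- Up to a unit, the monomial is the coefficient of α^s β^t in (x₂ + αx₁)^(j + s) (x₃ + βx₁)^(k + t).
  split-monomial : ∀ s t j k → j ℕ.+ s < p → k ℕ.+ t < p → suc (j ℕ.+ s) < p ⊎ suc (k ℕ.+ t) < p →
    SpanMod (monomial (s ℕ.+ t) j k)
  split-monomial s t j k m<p n<p strict = SpanMod.respects
    (λ x → trans (eq (x₃ x ^ᶻ k) (x₁ x ^ᶻ t) (x₂ x ^ᶻ j) (x₁ x ^ᶻ s))
      (cong (_* (x₂ x ^ᶻ j * x₃ x ^ᶻ k)) (sym (^-homo-* (x₁ x) s t))))
    (SpanMod.extract-coefficient {x₃} {x₁} {λ x → x₂ x ^ᶻ j * x₁ x ^ᶻ s} k t n<p λ β →
      SpanMod.respects (λ x → ℤ.*-comm (x₂ x ^ᶻ j * x₁ x ^ᶻ s) ((x₃ x + pos β * x₁ x) ^ᶻ (k ℕ.+ t)))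
        (SpanMod.extract-coefficient {x₂} {x₁} {λ x → (x₃ x + pos β * x₁ x) ^ᶻ (k ℕ.+ t)} j s m<p λ α →
          form-powers (slanted (pos α) (pos β)) (j ℕ.+ s) (k ℕ.+ t) strict))
    where
    eq : ∀ c t b s → c * t * (b * s) ≡ s * t * (b * c)
    eq = solve-∀

  -- Moments modulo p

  module Moments (f : Point → ℤ) where

    Orthogonal : (Point → ℤ) → Set
    Orthogonal h = P ∣ sumᵥ 3 (λ v → f v * h v)

    orthogonal : IsSubmodule Orthogonal
    orthogonal = record
      { respects = λ {g} {h} g≗h → subst (P ∣_) (sumᵥ-cong 3 λ v → cong (f v *_) (g≗h v))
      ; add      = λ {g} {h} P∣g P∣h → subst (P ∣_) (trans (sym (sumᵥ-+ 3 (λ v → f v * g v) (λ v → f v * h v)))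
                     (sumᵥ-cong 3 λ v → sym (ℤ.*-distribˡ-+ (f v) (g v) (h v)))) (ℤ∣.∣m∣n⇒∣m+n P∣g P∣h)
      ; scale    = λ c {g} P∣g → subst (P ∣_) (scaled c g) (ℤ∣.∣n⇒∣m*n c P∣g)
      ; multiple = λ g → subst (P ∣_) (scaled P g) (ℤ∣.∣m⇒∣m*n (sumᵥ 3 (λ v → f v * g v)) ℤ∣.∣-refl)
      }
      where
      scaled : ∀ c g → c * sumᵥ 3 (λ v → f v * g v) ≡ sumᵥ 3 (λ v → f v * (c * g v))
      scaled c g = trans (sym (sumᵥ-*ˡ 3 c (λ v → f v * g v))) (sumᵥ-cong 3 λ v → eq c (f v) (g v))
        where
        eq : ∀ c f g → c * (f * g) ≡ f * (c * g)
        eq = solve-∀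

    open IsSubmodule orthogonal

    -- Up to a unit, the monomial is the coefficient of α^j β^k in (x₁ + αx₂ + βx₃)^(i + j + k).
    low-moments : (∀ α β r → Orthogonal (λ x → ε (x₁ x + α * x₂ x + β * x₃ x - r))) →
      ∀ i j k → i ℕ.+ (j ℕ.+ k) < p → Orthogonal (monomial i j k)
    low-moments planes i j k d<p = respects (λ x → ℤ.*-assoc (x₁ x ^ᶻ i) (x₂ x ^ᶻ j) (x₃ x ^ᶻ k))
      (extract-coefficient {x₁} {x₂} {λ x → x₃ x ^ᶻ k} i j (ℕ.≤-<-trans (ℕ.m≤m+n (i ℕ.+ j) k) d<p′) λ α →
        respects (λ x → ℤ.*-identityʳ ((x₁ x + pos α * x₂ x) ^ᶻ (i ℕ.+ j) * x₃ x ^ᶻ k))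
          (extract-coefficient {λ x → x₁ x + pos α * x₂ x} {x₃} {λ _ → 1ℤ} (i ℕ.+ j) k d<p′ λ β →
            power-from-indicators orthogonal (i ℕ.+ j ℕ.+ k) {λ x → x₁ x + pos α * x₂ x + pos β * x₃ x} {λ _ → 1ℤ} λ r →
              respects (λ x → sym (ℤ.*-identityʳ (ε (x₁ x + pos α * x₂ x + pos β * x₃ x - ι r)))) (planes (pos α) (pos β) (ι r))))
      where
      d<p′ : i ℕ.+ j ℕ.+ k < p
      d<p′ = subst (_< p) (sym (ℕ.+-assoc i j k)) d<p

  -- Monomials of degree below 2(p - 1)

  q : ℕ
  q = ℕ.pred p

  suc-q : suc q ≡ p
  suc-q = ℕ.suc-pred p

  ≤q⇒<p : ∀ {n} → n ≤ q → n < p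
  ≤q⇒<p {n} n≤q = subst (n <_) suc-q (s≤s n≤q)

  -- Split i as s + t so that j + s and k + t are at most q and not both equal to q; the degree
  -- bound leaves room for this. All of i goes to j if it fits, otherwise s fills j up to q and the
  -- rest goes to k.
  high-monomial : ∀ i j k → i ≤ q → j ≤ q → k ≤ q → i ℕ.+ (j ℕ.+ k) < q ℕ.+ q → SpanMod (monomial i j k)
  high-monomial i j k i≤q j≤q k≤q d<2q with (j ℕ.+ i) ℕ.≤? q
  ... | yes j+i≤q = subst (λ n → SpanMod (monomial n j k)) (ℕ.+-identityʳ i)
    (split-monomial i 0 j k (≤q⇒<p j+i≤q) (≤q⇒<p k+0≤q) strict)
    where
    k+0≤q = subst (_≤ q) (sym (ℕ.+-identityʳ k)) k≤q
    eq : ∀ i j k → i ℕ.+ (j ℕ.+ k) ≡ j ℕ.+ i ℕ.+ k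
    eq = ℕ-solver.solve-∀
    strict : suc (j ℕ.+ i) < p ⊎ suc (k ℕ.+ 0) < p
    strict with (j ℕ.+ i) ℕ.<? q
    ... | yes j+i<q = inj₁ (≤q⇒<p j+i<q)
    -- With j + i at least q, the degree bound forces k < q.
    ... | no j+i≮q  = inj₂ (≤q⇒<p (subst (_< q) (sym (ℕ.+-identityʳ k))
      (ℕ.+-cancelˡ-< q k q (ℕ.≤-<-trans (ℕ.+-monoˡ-≤ k (ℕ.≮⇒≥ j+i≮q)) (subst (_< q ℕ.+ q) (eq i j k) d<2q)))))
  ... | no j+i≰q = subst (λ n → SpanMod (monomial n j k)) s+t≡i
    (split-monomial s t j k (≤q⇒<p (ℕ.≤-reflexive j+s≡q)) (≤q⇒<p (ℕ.<⇒≤ k+t<q)) (inj₂ (≤q⇒<p k+t<q)))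
    where
    s = q ∸ j
    t = i ∸ s
    j+s≡q : j ℕ.+ s ≡ q
    j+s≡q = ℕ.m+[n∸m]≡n j≤q
    s+t≡i : s ℕ.+ t ≡ i
    s+t≡i = ℕ.m+[n∸m]≡n (ℕ.m≤n+o⇒m∸n≤o q j (ℕ.<⇒≤ (ℕ.≰⇒> j+i≰q)))
    eq : ∀ s t j k → s ℕ.+ t ℕ.+ (j ℕ.+ k) ≡ j ℕ.+ s ℕ.+ (k ℕ.+ t)
    eq = ℕ-solver.solve-∀
    k+t<q : k ℕ.+ t < q
    k+t<q = ℕ.+-cancelˡ-< q (k ℕ.+ t) q (subst (_< q ℕ.+ q)
      (trans (cong (ℕ._+ (j ℕ.+ k)) (sym s+t≡i)) (trans (eq s t j k) (cong (ℕ._+ (k ℕ.+ t)) j+s≡q))) d<2q)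

  -- A reproducing kernel modulo p

  rising-0-indivisible : ∀ n → n < p → ¬ P ∣ rising n 0ℤ
  rising-0-indivisible zero    0<p = n!-indivisible 0 0<p
  rising-0-indivisible (suc n) n<p = ∤-* (rising n 0ℤ) (0ℤ + pos (suc n)) (rising-0-indivisible n (ℕ.<-trans (ℕ.n<1+n n) n<p))
    (subst (λ z → ¬ P ∣ z) (sym (ℤ.+-identityˡ (pos (suc n)))) (∤-small n<p))

  -- This is (p - 1)!, the value of the one-variable kernel on the diagonal.
  c₀ : ℤ
  c₀ = rising q 0ℤ

  -- The residue t of b - a lies between 1 and p - 1, so a - b + t is one of the factors, and it is
  -- divisible by p.
  rising-vanishes : ∀ a b → a ≢ b → P ∣ rising q (ι a - ι b)
  rising-vanishes a b a≢b = by-residue (toℕ t) refl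
    where
    t = ρ (ι b - ι a)
    eq₁ : ∀ a b → b ≡ (b - a) + a
    eq₁ = solve-∀
    eq₂ : ∀ a b → a - b + (b - a) ≡ 0ℤ
    eq₂ = solve-∀
    by-residue : ∀ n → toℕ t ≡ n → P ∣ rising q (ι a - ι b)
    by-residue zero    t≡0 = contradiction (sym (ι-injective (≋-trans (≋-reflexive (eq₁ (ι a) (ι b)))
      (≋-trans (+-cong-≋ (≋-trans (≋-sym (ι-ρ (ι b - ι a))) (≋-reflexive (cong pos t≡0))) (≋-refl {ι a})) (≋-reflexive (ℤ.+-identityˡ (ι a))))))) a≢b
    by-residue (suc k) t≡k = rising-divisible q (ι a - ι b) k (ℕ.≤-pred (subst₂ _<_ t≡k (sym suc-q) (toℕ<n t)))
      (≋0⇒∣ (≋-trans (+-cong-≋ (≋-refl {ι a - ι b}) (≋-trans (≋-reflexive (cong pos (sym t≡k))) (ι-ρ (ι b - ι a)))) (≋-reflexive (eq₂ (ι a) (ι b)))))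

  reproduce : ∀ (F : 𝔽 → ℤ) b → sum (λ a → F a * rising q (ι a - ι b)) ≋ F b * c₀
  reproduce F b = ≋-trans (sum-single-≋ (λ a → F a * rising q (ι a - ι b)) b λ a a≢b → ℤ∣.∣n⇒∣m*n (F a) (rising-vanishes a b a≢b))
    (≋-reflexive (cong (λ z → F b * rising q z) (ℤ.+-inverseʳ (ι b))))

  sum-cong-≋ : ∀ {n} {f g : Fin n → ℤ} → (∀ i → f i ≋ g i) → sum f ≋ sum g
  sum-cong-≋ {zero}  f≋g = ≋-refl
  sum-cong-≋ {suc n} f≋g = +-cong-≋ (f≋g zero) (sum-cong-≋ (f≋g ∘ suc))

  y₁ y₂ y₃ z₁ z₂ z₃ : Point × Point → ℤ
  y₁ (v , w) = x₁ v
  y₂ (v , w) = x₂ v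
  y₃ (v , w) = x₃ v
  z₁ (v , w) = x₁ w
  z₂ (v , w) = x₂ w
  z₃ (v , w) = x₃ w

  kernel : Point × Point → ℤ
  kernel u = rising q (y₁ u - z₁ u) * (rising q (y₂ u - z₂ u) * (rising q (y₃ u - z₃ u) * 1ℤ))

  kernel-reproduces : ∀ (f : Point → ℤ) w → sumᵥ 3 (λ v → f v * kernel (v , w)) ≋ c₀ * c₀ * c₀ * f w
  kernel-reproduces f w@(a ∷ b ∷ c ∷ []) = ≋-trans
    (sum-cong-≋ λ r → ≋-trans
      (sum-cong-≋ λ s → ≋-trans
        (≋-reflexive (sum-cong-≗ λ t → eq₁ (f (r ∷ s ∷ t ∷ [])) (rising q (ι r - ι a)) (rising q (ι s - ι b)) (rising q (ι t - ι c))))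
        (reproduce (λ t → f (r ∷ s ∷ t ∷ []) * rising q (ι r - ι a) * rising q (ι s - ι b)) c))
      (≋-trans (≋-reflexive (sum-cong-≗ λ s → eq₂ (f (r ∷ s ∷ c ∷ [])) (rising q (ι r - ι a)) (rising q (ι s - ι b)) c₀))
        (reproduce (λ s → f (r ∷ s ∷ c ∷ []) * c₀ * rising q (ι r - ι a)) b)))
    (≋-trans (≋-reflexive (sum-cong-≗ λ r → eq₃ (f (r ∷ b ∷ c ∷ [])) (rising q (ι r - ι a)) c₀))
      (≋-trans (reproduce (λ r → f (r ∷ b ∷ c ∷ []) * c₀ * c₀) a) (≋-reflexive (eq₄ (f w) c₀))))
    where
    eq₁ : ∀ f r s t → f * (r * (s * (t * 1ℤ))) ≡ f * r * s * t
    eq₁ = solve-∀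
    eq₂ : ∀ f r s c → f * r * s * c ≡ f * c * r * s
    eq₂ = solve-∀
    eq₃ : ∀ f r c → f * c * r * c ≡ f * c * c * r
    eq₃ = solve-∀
    eq₄ : ∀ f c → f * c * c * c ≡ c * c * c * f
    eq₄ = solve-∀

  module _ (f : Point → ℤ) where
    open Moments f using (Orthogonal)

    -- G acts as a kernel that turns f into a function of w. The condition is linear in G, so a
    -- kernel can be treated one monomial at a time.
    Smoothing : (Point × Point → ℤ) → Set
    Smoothing G = SpanMod (λ w → sumᵥ 3 (λ v → f v * G (v , w)))

    smoothing : IsSubmodule Smoothing
    smoothing = record
      { respects = λ g≗h → SpanMod.respects (λ w → sumᵥ-cong 3 λ v → cong (f v *_) (g≗h (v , w)))
      ; add      = λ {g} {h} Kg Kh → SpanMod.respects (λ w → trans (sym (sumᵥ-+ 3 (λ v → f v * g (v , w)) (λ v → f v * h (v , w))))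
                     (sumᵥ-cong 3 λ v → sym (ℤ.*-distribˡ-+ (f v) (g (v , w)) (h (v , w)))))
                     (SpanMod.add {λ w → sumᵥ 3 (λ v → f v * g (v , w))} {λ w → sumᵥ 3 (λ v → f v * h (v , w))} Kg Kh)
      ; scale    = λ c {g} Kg → SpanMod.respects (scaled c g) (SpanMod.scale c Kg)
      ; multiple = λ g → SpanMod.respects (scaled P g) (SpanMod.multiple (λ w → sumᵥ 3 (λ v → f v * g (v , w))))
      }
      where
      scaled : ∀ c g w → c * sumᵥ 3 (λ v → f v * g (v , w)) ≡ sumᵥ 3 (λ v → f v * (c * g (v , w)))
      scaled c g w = trans (sym (sumᵥ-*ˡ 3 c (λ v → f v * g (v , w)))) (sumᵥ-cong 3 λ v → eq c (f v) (g (v , w)))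
        where
        eq : ∀ c f g → c * (f * g) ≡ f * (c * g)
        eq = solve-∀

    open IsSubmodule smoothing

    module _ (low : ∀ i j k → i ℕ.+ (j ℕ.+ k) < p → Orthogonal (monomial i j k)) where

      -- The variables separate into a moment of f times a monomial in w. Either the moment has
      -- degree below p and vanishes modulo p, or the degree in w is small enough for
      -- `high-monomial`.
      monomial-smoothing : ∀ i₁ j₁ i₂ j₂ i₃ j₃ → i₁ ℕ.+ j₁ ≤ q → i₂ ℕ.+ j₂ ≤ q → i₃ ℕ.+ j₃ ≤ q →
        Smoothing (λ u → y₁ u ^ᶻ i₁ * z₁ u ^ᶻ j₁ * (y₂ u ^ᶻ i₂ * z₂ u ^ᶻ j₂ * (y₃ u ^ᶻ i₃ * z₃ u ^ᶻ j₃ * 1ℤ)))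
      monomial-smoothing i₁ j₁ i₂ j₂ i₃ j₃ h₁ h₂ h₃ = SpanMod.respects (λ w → trans
          (sym (sumᵥ-*ʳ 3 (monomial j₁ j₂ j₃ w) (λ v → f v * monomial i₁ i₂ i₃ v)))
          (sumᵥ-cong 3 λ v → eq (f v) (x₁ v ^ᶻ i₁) (x₁ w ^ᶻ j₁) (x₂ v ^ᶻ i₂) (x₂ w ^ᶻ j₂) (x₃ v ^ᶻ i₃) (x₃ w ^ᶻ j₃)))
        separated
        where
        eq : ∀ f a A b B c C → f * (a * (b * c)) * (A * (B * C)) ≡ f * (a * A * (b * B * (c * C * 1ℤ)))
        eq = solve-∀
        separated : SpanMod (λ w → sumᵥ 3 (λ v → f v * monomial i₁ i₂ i₃ v) * monomial j₁ j₂ j₃ w)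
        separated with (i₁ ℕ.+ (i₂ ℕ.+ i₃)) ℕ.<? p
        ... | yes i<p = SpanMod.null (λ w → ℤ∣.∣m⇒∣m*n (monomial j₁ j₂ j₃ w) (low i₁ i₂ i₃ i<p))
        ... | no i≮p  = SpanMod.scale (sumᵥ 3 (λ v → f v * monomial i₁ i₂ i₃ v))
          (high-monomial j₁ j₂ j₃ (ℕ.m+n≤o⇒n≤o i₁ h₁) (ℕ.m+n≤o⇒n≤o i₂ h₂) (ℕ.m+n≤o⇒n≤o i₃ h₃)
            -- The total degree is at most 3q and the degree in v is at least q + 1, so less than 2q
            -- is left for w.
            (ℕ.+-cancelˡ-< q (j₁ ℕ.+ (j₂ ℕ.+ j₃)) (q ℕ.+ q)
              (ℕ.<-≤-trans (ℕ.+-monoˡ-< (j₁ ℕ.+ (j₂ ℕ.+ j₃)) (subst (_≤ i₁ ℕ.+ (i₂ ℕ.+ i₃)) (sym suc-q) (ℕ.≮⇒≥ i≮p)))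
                (subst (_≤ q ℕ.+ (q ℕ.+ q)) (eqℕ i₁ j₁ i₂ j₂ i₃ j₃) (ℕ.+-mono-≤ h₁ (ℕ.+-mono-≤ h₂ h₃))))))
          where
          eqℕ : ∀ i₁ j₁ i₂ j₂ i₃ j₃ → i₁ ℕ.+ j₁ ℕ.+ (i₂ ℕ.+ j₂ ℕ.+ (i₃ ℕ.+ j₃)) ≡ i₁ ℕ.+ (i₂ ℕ.+ i₃) ℕ.+ (j₁ ℕ.+ (j₂ ℕ.+ j₃))
          eqℕ = ℕ-solver.solve-∀

      -- Expand one coordinate at a time. The monomials already produced and the factors still
      -- waiting make up the weight, and the `swap` identities bring the next factor to the front.
      kernel-smoothing : Smoothing kernel
      kernel-smoothing =
        rising-from-monomials q {y₁} {z₁} {λ u → rising q (y₂ u - z₂ u) * (rising q (y₃ u - z₃ u) * 1ℤ)} λ i₁ j₁ h₁ →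
          respects (λ u → swap₁ (y₁ u ^ᶻ i₁ * z₁ u ^ᶻ j₁) (rising q (y₂ u - z₂ u)) (rising q (y₃ u - z₃ u)))
            (rising-from-monomials q {y₂} {z₂} {λ u → y₁ u ^ᶻ i₁ * z₁ u ^ᶻ j₁ * rising q (y₃ u - z₃ u)} λ i₂ j₂ h₂ →
              respects (λ u → swap₂ (y₁ u ^ᶻ i₁ * z₁ u ^ᶻ j₁) (y₂ u ^ᶻ i₂ * z₂ u ^ᶻ j₂) (rising q (y₃ u - z₃ u)))
                (rising-from-monomials q {y₃} {z₃} {λ u → y₂ u ^ᶻ i₂ * z₂ u ^ᶻ j₂ * (y₁ u ^ᶻ i₁ * z₁ u ^ᶻ j₁)} λ i₃ j₃ h₃ →
                  respects (λ u → swap₃ (y₁ u ^ᶻ i₁ * z₁ u ^ᶻ j₁) (y₂ u ^ᶻ i₂ * z₂ u ^ᶻ j₂) (y₃ u ^ᶻ i₃ * z₃ u ^ᶻ j₃))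
                    (monomial-smoothing i₁ j₁ i₂ j₂ i₃ j₃ h₁ h₂ h₃)))
        where
        swap₁ : ∀ m r s → r * (m * s) ≡ m * (r * (s * 1ℤ))
        swap₁ = solve-∀
        swap₂ : ∀ m n s → s * (n * m) ≡ n * (m * s)
        swap₂ = solve-∀
        swap₃ : ∀ m n l → m * (n * (l * 1ℤ)) ≡ l * (n * m)
        swap₃ = solve-∀

      -- Smoothing by the kernel returns f times the unit c₀³ modulo p.
      low-moments⇒SpanMod : SpanMod f
      low-moments⇒SpanMod = SpanMod.cancel (c₀ * c₀ * c₀) (∤-* (c₀ * c₀) c₀ (∤-* c₀ c₀ c₀-indivisible c₀-indivisible) c₀-indivisible)
        (SpanMod.resp-≋ {λ w → sumᵥ 3 (λ v → f v * kernel (v , w))} (kernel-reproduces f) kernel-smoothing)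
        where
        c₀-indivisible : ¬ P ∣ c₀
        c₀-indivisible = rising-0-indivisible q (≤q⇒<p ℕ.≤-refl)

  -- Both f and f - p m have total 0, hence so does m, and p m can be added back by `p-multiple`.
  total-zero⇒DifferenceSpan : ∀ {f} → SpanMod f → sumᵥ 3 f ≡ 0ℤ → DifferenceSpan f
  total-zero⇒DifferenceSpan {f} (m , D) Σf≡0 = pointwise (λ x → eq (f x) (P * m x)) (plus D (p-multiple m Σm≡0))
    where
    eq : ∀ a b → a - b + b ≡ a
    eq = solve-∀
    Σf-PΣm≡0 : sumᵥ 3 f - P * sumᵥ 3 m ≡ 0ℤ
    Σf-PΣm≡0 = trans (cong (λ z → sumᵥ 3 f - z) (sym (sumᵥ-*ˡ 3 P m))) (trans (sym (sumᵥ-minus 3 f (λ x → P * m x))) (total-zero D))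
    PΣm≡0 : P * sumᵥ 3 m ≡ P * 0ℤ
    PΣm≡0 = trans (sym (ℤ.i-j≡0⇒i≡j (sumᵥ 3 f) (P * sumᵥ 3 m) Σf-PΣm≡0)) (trans Σf≡0 (sym (ℤ.*-zeroʳ P)))
    Σm≡0 : sumᵥ 3 m ≡ 0ℤ
    Σm≡0 = ℤ.*-cancelˡ-≡ P (sumᵥ 3 m) 0ℤ PΣm≡0

  -- Comparison with the plane x₁ = 0

  base-plane : PointSet
  base-plane = graph vertical₃ (λ _ → 0ℤ)

  base-plane-isPlane : IsPlane base-plane
  base-plane-isPlane = let a , us , independent , translate = plane-isPlane 0ℤ 0ℤ 0ℤ in
    a , us , independent , λ x → subst (λ z → (⌊ P ∣? z ⌋ ≡ true) ⇔ (∃[ cs ] x ≡ a +ᵥ combination cs us)) (eq (x₁ x) (x₂ x) (x₃ x)) (translate x)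
    where
    eq : ∀ a b c → a + 0ℤ * b + 0ℤ * c - 0ℤ ≡ a - 0ℤ
    eq = solve-∀

  -- The plane is the sum of its p lines x₂ = r. Moving each to x₂ = 0 costs a line difference and
  -- leaves p times one line; this is the case of exponent 0.
  base-plane-SpanMod : SpanMod (𝟙 base-plane)
  base-plane-SpanMod = SpanMod.respects (λ x → ℤ.*-identityˡ (𝟙 base-plane x))
    (power-from-differences spanMod 0 (ℕ.nonTrivial⇒n>1 p {{prime⇒nonTrivial p-prime}}) {x₂} {𝟙 base-plane} λ r →
      line-difference (swap vertical₃) (ι r) 0ℤ 0ℤ)

  sumᵥ-const : ∀ n x → sumᵥ n (λ _ → x) ≡ pos (p ℕ.^ n) * x
  sumᵥ-const zero    x = sym (ℤ.*-identityˡ x)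
  sumᵥ-const (suc n) x = trans (sum-cong-≗ {n = p} λ _ → sumᵥ-const n x) (trans (sum-const p (pos (p ℕ.^ n) * x))
    (trans (sym (ℤ.*-assoc P (pos (p ℕ.^ n)) x)) (cong (_* x) (sym (pos-* p (p ℕ.^ n))))))

  base-plane-total : sumᵥ 3 (𝟙 base-plane) ≡ pos (p ℕ.^ 2)
  base-plane-total = begin
    sum (λ a → sumᵥ 2 (λ _ → ε (ι a - 0ℤ)))       ≡⟨ sum-cong-≗ (λ a → sumᵥ-const 2 (ε (ι a - 0ℤ))) ⟩
    sum (λ a → pos (p ℕ.^ 2) * ε (ι a - 0ℤ))      ≡⟨ sym (*-distribˡ-sum (pos (p ℕ.^ 2)) (λ a → ε (ι a - 0ℤ))) ⟩
    pos (p ℕ.^ 2) * sum (λ a → ε (ι a - 0ℤ))      ≡⟨ cong (pos (p ℕ.^ 2) *_) (sum-ε-at 0ℤ) ⟩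
    pos (p ℕ.^ 2) * 1ℤ                            ≡⟨ ℤ.*-identityʳ (pos (p ℕ.^ 2)) ⟩
    pos (p ℕ.^ 2)                                 ∎
    where open ≡-Reasoning

  𝟙-∩ : ∀ X Y x → 𝟙 (X ∩ Y) x ≡ 𝟙 X x * 𝟙 Y x
  𝟙-∩ X Y x with X x | Y x
  ... | true  | true  = refl
  ... | true  | false = refl
  ... | false | true  = refl
  ... | false | false = refl

  divisible⇒low-moments : ∀ S → IsDivisible S → ∀ i j k → i ℕ.+ (j ℕ.+ k) < p → Moments.Orthogonal (𝟙 S) (monomial i j k)
  divisible⇒low-moments S S-divisible = Moments.low-moments (𝟙 S) λ α β r →
    subst (P ∣_) (trans (∣∣ₛ-sum (S ∩ plane α β r)) (sumᵥ-cong 3 (𝟙-∩ S (plane α β r))))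
      (∣ᵤ⇒∣ (S-divisible (plane α β r) (plane-isPlane α β r)))

  -- Subtracting a plane, which also has p² points, brings the total to 0, and this is what lifts
  -- the congruence modulo p to the integers.
  divisible⇒DifferenceSpan : ∀ S → ∣ S ∣ₛ ≡ p ℕ.^ 2 → IsDivisible S → DifferenceSpan (λ x → 𝟙 S x - 𝟙 base-plane x)
  divisible⇒DifferenceSpan S size S-divisible = total-zero⇒DifferenceSpan
    (SpanMod.subtract {𝟙 S} {𝟙 base-plane} (low-moments⇒SpanMod (𝟙 S) (divisible⇒low-moments S S-divisible)) base-plane-SpanMod)
    (trans (sumᵥ-minus 3 (𝟙 S) (𝟙 base-plane)) (trans (cong₂ _-_ (trans (sym (∣∣ₛ-sum S)) (cong pos size)) base-plane-total) (ℤ.+-inverseʳ (pos (p ℕ.^ 2)))))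

theorem1p12 : (p : ℕ) (p-prime : Prime p) →
    let open AffineSpace p {{prime⇒nonZero p-prime}} in
    (S : PointSet) → ∣ S ∣ₛ ≡ p ^ 2 → IsDivisible S →
    Spanℤ CylinderIndicator (𝟙 S)
    × (∃[ H ] IsPlane H × (Σ (Point → ℤ) λ d →
    Spanℤ ParallelLineDifference d × (∀ x → 𝟙 S x ≡ 𝟙 H x + d x)))
theorem1p12 p p-prime S size S-divisible =
    -- `base-plane` is a graph over `vertical₃`, so it is itself a cylinder and enters as one
    -- generator.
    Span-resp (λ x → sym (split x)) (Span-add (Span-generator (graph-indicator vertical₃ (λ _ → 0ℤ))) (to-cylinders D))
  , base-plane , base-plane-isPlane , (λ x → 𝟙 S x - 𝟙 base-plane x) , to-parallel-lines D , split
  where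
  open AffineSpace p {{prime⇒nonZero p-prime}}
  open PrimeModulus p p-prime
  open IntegerSpan CylinderIndicator
  D = divisible⇒DifferenceSpan S size S-divisible
  split : ∀ x → 𝟙 S x ≡ 𝟙 base-plane x + (𝟙 S x - 𝟙 base-plane x)
  split x = eq (𝟙 S x) (𝟙 base-plane x)
    where
    eq : ∀ a b → a ≡ b + (a - b)
    eq = solve-∀
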